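{- Let $q$ be a prime power, let $V=\mathbb{F}_q^{10}$ carry a nondegenerate quadratic form of plus type (hyperbolic), and let $\mathcal{M}$ be one of the two families of maximal totally singular subspaces (of dimension $5$) of $V$. Let $\Gamma$ be the graph with vertex set $\mathcal{M}$, two members being adjacent if their intersection has dimension $3$. Then $\Gamma$ is separating.
   Context: This graph is a connected component of the distance-$2$ graph of the dual polar graph of the polar space of rank $5$ and order $(q,1)$; it has $(q^4+1)(q^3+1)(q^2+1)(q+1)$ vertices. A graph $\Gamma$ is separating if $\omega(\Gamma)\alpha(\Gamma)<|V(\Gamma)|$, where $\omega$ and $\alpha$ are the maximum clique and coclique sizes. -}

module Defs where

open import Level using (0ℓ)
open import Algebra.Bundles using (CommutativeRing)
open import Data.Nat as ℕ using (ℕ; zero; suc)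
open import Data.Nat.DivMod using (_%_)
open import Data.Nat.Primality using (Prime)
open import Data.Fin using (Fin; zero; suc)
open import Data.Product using (Σ; ∃; _×_; _,_)
open import Data.List using (List; length)
open import Data.List.Relation.Unary.All using (All)
open import Data.List.Relation.Unary.Any using (Any)
open import Data.List.Relation.Unary.AllPairs using (AllPairs)
open import Relation.Nullary using (¬_)
open import Relation.Binary.PropositionalEquality using (_≡_)

IsPrimePower : ℕ → Set
IsPrimePower q = Σ ℕ λ p → Σ ℕ λ n → Prime p × q ≡ p ℕ.^ suc n

module Geometry (R : CommutativeRing 0ℓ 0ℓ) where
  open CommutativeRing R renaming (Carrier to F) hiding (zero)

  IsField : Set
  IsField = (¬ (1# ≈ 0#)) × (∀ x → ¬ (x ≈ 0#) → ∃ λ y → x * y ≈ 1#)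

  HasOrder : ℕ → Set
  HasOrder q = Σ (Fin q → F) λ e →
    (∀ x → ∃ λ i → e i ≈ x) × (∀ i j → e i ≈ e j → i ≡ j)

  V : ℕ → Set
  V n = Fin n → F

  sumF : ∀ {k} → (Fin k → F) → F
  sumF {zero} f = 0#
  sumF {suc k} f = f zero + sumF (λ i → f (suc i))

  _≈ᵥ_ : ∀ {n} → V n → V n → Set
  u ≈ᵥ v = ∀ j → u j ≈ v j

  _+ᵥ_ : ∀ {n} → V n → V n → V n
  (u +ᵥ v) j = u j + v j

  _·ᵥ_ : ∀ {n} → F → V n → V n
  (a ·ᵥ v) j = a * v j

  0ᵥ : ∀ {n} → V n
  0ᵥ j = 0#

  lincomb : ∀ {n k} → (Fin k → F) → (Fin k → V n) → V n
  lincomb c b j = sumF (λ i → c i * b i j)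

  InSpan : ∀ {n k} → (Fin k → V n) → V n → Set
  InSpan b v = ∃ λ c → v ≈ᵥ lincomb c b

  LinIndep : ∀ {n k} → (Fin k → V n) → Set
  LinIndep b = ∀ c → lincomb c b ≈ᵥ 0ᵥ → ∀ i → c i ≈ 0#

  HasDim : ∀ {n} → (V n → Set) → ℕ → Set
  HasDim {n} P k = Σ (Fin k → V n) λ b →
    (∀ i → P (b i)) × LinIndep b × (∀ v → P v → InSpan b v)

  polar : ∀ {n} → (V n → F) → V n → V n → F
  polar Q u v = Q (u +ᵥ v) - Q u - Q v

  IsQuadraticForm : ∀ {n} → (V n → F) → Set
  IsQuadraticForm {n} Q =
    (∀ u v → u ≈ᵥ v → Q u ≈ Q v) ×
    (∀ a v → Q (a ·ᵥ v) ≈ a * a * Q v) ×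
    (∀ u v w → polar Q (u +ᵥ v) w ≈ polar Q u w + polar Q v w) ×
    (∀ a u w → polar Q (a ·ᵥ u) w ≈ a * polar Q u w)

  Nondegenerate : ∀ {n} → (V n → F) → Set
  Nondegenerate Q = ∀ u → (∀ v → polar Q u v ≈ 0#) → u ≈ᵥ 0ᵥ

  TotallySingular : ∀ {n k} → (V n → F) → (Fin k → V n) → Set
  TotallySingular Q b = ∀ v → InSpan b v → Q v ≈ 0#

  TSSubspace : ∀ {n} → (V n → F) → (k : ℕ) → (Fin k → V n) → Set
  TSSubspace Q k b = LinIndep b × TotallySingular Q b

  -- plus type (hyperbolic) on F^(2m): nondegenerate with Witt index m
  PlusType : (m : ℕ) → (V (m ℕ.+ m) → F) → Set
  PlusType m Q = Nondegenerate Q × ∃ λ b → TSSubspace Q m b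

  -- The graph for rank 5: V = F^10, vertices = maximal totally
  -- singular (= 5-dimensional) subspaces, represented by bases.
  Gen : Set
  Gen = Fin 5 → V 10

  SameSpace : Gen → Gen → Set
  SameSpace b b' = ∀ v → (InSpan b v → InSpan b' v) × (InSpan b' v → InSpan b v)

  Meet : Gen → Gen → V 10 → Set
  Meet b b' v = InSpan b v × InSpan b' v

  Adjacent : Gen → Gen → Set
  Adjacent b b' = HasDim (Meet b b') 3

  -- the family of M0: the generators meeting M0 in odd dimension
  -- (codimension of the intersection even)
  InFamily : (V 10 → F) → Gen → Gen → Set
  InFamily Q M0 M = TSSubspace Q 5 M × ∃ λ k → HasDim (Meet M M0) k × k % 2 ≡ 1

  IsVertexList : (V 10 → F) → Gen → List Gen → Set
  IsVertexList Q M0 L =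
    All (InFamily Q M0) L ×
    AllPairs (λ b b' → ¬ SameSpace b b') L ×
    (∀ M → InFamily Q M0 M → Any (SameSpace M) L)

  IsClique : (V 10 → F) → Gen → List Gen → Set
  IsClique Q M0 C =
    All (InFamily Q M0) C ×
    AllPairs (λ b b' → (¬ SameSpace b b') × Adjacent b b') C

  IsCoclique : (V 10 → F) → Gen → List Gen → Set
  IsCoclique Q M0 D =
    All (InFamily Q M0) D ×
    AllPairs (λ b b' → (¬ SameSpace b b') × (¬ Adjacent b b')) D

  -- separating: ω · α < |V|, i.e. every clique size times every
  -- coclique size is below the number of vertices
  Separating : (V 10 → F) → Gen → Set
  Separating Q M0 = ∀ C D L →
    IsClique Q M0 C → IsCoclique Q M0 D → IsVertexList Q M0 L →
    length C ℕ.* length D ℕ.< length L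

{-# OPTIONS --safe #-}
-- Call two generators (maximal totally singular subspaces) neighbours, M ~ N, if they meet in codimension 1, and put
-- Φ = 1 + q + q² + q³ + q⁴.  Every generator has Φ neighbours, and M, K are adjacent in Γ iff they are distinct with a
-- common neighbour, in which case they have exactly q + 1 of them; three pairwise adjacent generators have a common
-- neighbour.  The bounds for cliques and cocliques follow from these facts by counting.
--   Cliques: if the members share a neighbour there are at most Φ of them, and otherwise at most (q + 1)³ ≤ Φ.
--   Cocliques D: the members of D adjacent to a given x ∉ D occupy disjoint (q + 1)-subsets of the Φ neighbours of x.
-- As Φ ≡ 1 mod (q + 1), at least one neighbour is left over, and counting the walks d ~ N ~ x with d ∈ D gives
-- |D| Φ² ≤ |V(Γ)| (Φ − 1) + |D|, that is |D| (Φ + 1) ≤ |V(Γ)|.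
module Submission where

open import Defs
open import Level using (0ℓ)
open import Algebra.Bundles using (CommutativeRing)
open import Data.Nat as ℕ using (ℕ; zero; suc; z≤n; s≤s; _≤_; _<_)
import Data.Nat.Properties as ℕₚ
open import Data.Nat.DivMod using (_%_)
open import Data.Nat.Divisibility using (_∣_; divides; ∣m+n∣m⇒∣n; ∣1⇒≡1)
open import Data.Nat.Tactic.RingSolver using (solve-∀)
open import Data.Fin using (Fin; zero; suc; funToFin; finToFun; combine; splitAt; _↑ˡ_; _↑ʳ_; join)
import Data.Fin.Properties as Finₚ
open import Data.Product using (Σ; ∃; _×_; _,_; proj₁; proj₂; swap)
open import Data.Sum using (_⊎_; inj₁; inj₂)
open import Data.Empty using (⊥-elim)
open import Data.Vec.Functional using ([]; _∷_; _++_)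
open import Data.Vec.Functional.Properties using (lookup-++ˡ; lookup-++ʳ)
open import Data.List using (List; length; lookup; concat; tabulate; deduplicate)
open import Data.List.Relation.Unary.All as All using (All)
open import Data.List.Relation.Unary.Any as Any using (Any)
import Data.List.Relation.Unary.Any.Properties as Anyₚ
open import Data.List.Relation.Unary.AllPairs as AllPairs using (AllPairs)
open import Data.List.Relation.Unary.Unique.DecSetoid.Properties using (deduplicate-!)
open import Data.List.Membership.Propositional.Properties using (∈-lookup)
open import Function using (_∘_)
open import Relation.Binary.Bundles using (DecSetoid)
open import Relation.Nullary using (¬_; Dec; yes; no)
open import Relation.Nullary.Decidable using (map′; ¬?; _×-dec_; decidable-stable)
open import Relation.Binary.PropositionalEquality as ≡ using (_≡_; _≢_)

-- The geometry turns on one fact: if M ~ N, then for every generator G one of G ∩ M and G ∩ N is a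
-- hyperplane of the other (`step`). So two steps preserve the parity that cuts out the family, and
-- the ends of such a walk, when distinct, meet in codimension 2. This is why Γ can be read off the
-- bipartite graph between the two families. The counting sees only the 0-1 matrix of that graph;
-- the number of vertices is never evaluated, it enters just as the number of rows in a double
-- count. Both constants count points of projective spaces: neighbours of M are parametrised by the
-- nonzero functionals on M up to scalars, common neighbours of M and K by the points of the
-- projective line on K / (M ∩ K). Generators are given by bases and are equal only up to span, so
-- every count passes through chosen representatives.

module Counting where
  open import Data.Nat using (_+_; _*_)
  open ℕₚ hiding (suc-injective)
  open Finₚ using (any?; all?; suc-injective) renaming (_≟_ to _≟F_)
  open ≡ using (refl; sym; trans; cong; cong₂; subst; module ≡-Reasoning)
  open import Algebra.Properties.Semiring.Sum +-*-semiring
    using (sum; sum-cong-≗; sum-replicate-zero; ∑-comm; ∑-distrib-+; *-distribˡ-sum; *-distribʳ-sum)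

  -- Indicator sums over finite index sets.

  𝟙 : ∀ {p} {P : Set p} → Dec P → ℕ
  𝟙 (yes _) = 1
  𝟙 (no _) = 0

  𝟙-yes : ∀ {p} {P : Set p} (d : Dec P) → P → 𝟙 d ≡ 1
  𝟙-yes (yes _) p = refl
  𝟙-yes (no ¬p) p = ⊥-elim (¬p p)

  𝟙-no : ∀ {p} {P : Set p} (d : Dec P) → ¬ P → 𝟙 d ≡ 0
  𝟙-no (yes p) ¬p = ⊥-elim (¬p p)
  𝟙-no (no _) ¬p = refl

  𝟙≤1 : ∀ {p} {P : Set p} (d : Dec P) → 𝟙 d ≤ 1
  𝟙≤1 (yes _) = ≤-refl
  𝟙≤1 (no _) = z≤n

  sum-mono : ∀ {n} {f g : Fin n → ℕ} → (∀ i → f i ≤ g i) → sum f ≤ sum g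
  sum-mono {zero} h = z≤n
  sum-mono {suc n} h = +-mono-≤ (h zero) (sum-mono (h ∘ suc))

  sum-const : ∀ n c → sum {n} (λ _ → c) ≡ n * c
  sum-const zero c = refl
  sum-const (suc n) c = cong (c +_) (sum-const n c)

  sum-0 : ∀ {n} {f : Fin n → ℕ} → (∀ i → f i ≡ 0) → sum f ≡ 0
  sum-0 {n} h = trans (sum-cong-≗ h) (sum-replicate-zero n)

  term≤sum : ∀ {n} (f : Fin n → ℕ) i → f i ≤ sum f
  term≤sum f zero = m≤m+n _ _
  term≤sum f (suc i) = ≤-trans (term≤sum (f ∘ suc) i) (m≤n+m _ _)

  sum-single : ∀ {n} (f : Fin n → ℕ) i → (∀ j → j ≢ i → f j ≡ 0) → sum f ≡ f i
  sum-single f zero h = trans (cong (f zero +_) (sum-0 λ j → h (suc j) λ ())) (+-identityʳ _)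
  sum-single f (suc i) h =
    trans (cong (_+ sum (f ∘ suc)) (h zero λ ()))
          (sum-single (f ∘ suc) i λ j j≢i → h (suc j) (j≢i ∘ suc-injective))

  Inj : ∀ {k n} → (Fin k → Fin n) → Set
  Inj f = ∀ {s t} → f s ≡ f t → s ≡ t

  sum-𝟙≤1 : ∀ {k p} {P : Fin k → Set p} (P? : ∀ s → Dec (P s)) →
    (∀ {s t} → P s → P t → s ≡ t) → sum (λ s → 𝟙 (P? s)) ≤ 1
  sum-𝟙≤1 P? u with any? P?
  ... | yes (s , ps) = ≤-trans
    (≤-reflexive (sum-single _ s λ t t≢s → 𝟙-no (P? t) λ pt → t≢s (u pt ps))) (𝟙≤1 (P? s))
  ... | no ¬∃ = ≤-trans (≤-reflexive (sum-0 λ s → 𝟙-no (P? s) λ ps → ¬∃ (s , ps))) z≤n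

  sum-𝟙≟ : ∀ {n} i → sum {n} (λ j → 𝟙 (i ≟F j)) ≡ 1
  sum-𝟙≟ i = trans (sum-single _ i λ j j≢i → 𝟙-no (i ≟F j) (j≢i ∘ sym)) (𝟙-yes (i ≟F i) refl)

  sum-𝟙≟-* : ∀ {n} (g : Fin n → ℕ) i → sum (λ j → 𝟙 (i ≟F j) * g j) ≡ g i
  sum-𝟙≟-* g i = trans
    (sum-single _ i λ j j≢i → cong (_* g j) (𝟙-no (i ≟F j) (j≢i ∘ sym)))
    (trans (cong (_* g i) (𝟙-yes (i ≟F i) refl)) (*-identityˡ _))

  sum-inj-≤ : ∀ {k m} (c : Fin k → Fin m) → Inj c → (g : Fin m → ℕ) → sum (g ∘ c) ≤ sum g
  sum-inj-≤ c inj g = begin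
    sum (λ s → g (c s))                            ≡⟨ sum-cong-≗ (λ s → sum-𝟙≟-* g (c s)) ⟨
    sum (λ s → sum (λ i → 𝟙 (c s ≟F i) * g i))     ≡⟨ ∑-comm (λ s i → 𝟙 (c s ≟F i) * g i) ⟩
    sum (λ i → sum (λ s → 𝟙 (c s ≟F i) * g i))     ≡⟨ sum-cong-≗ (λ i → *-distribʳ-sum (g i) (λ s → 𝟙 (c s ≟F i))) ⟨
    sum (λ i → sum (λ s → 𝟙 (c s ≟F i)) * g i)     ≤⟨ sum-mono (λ i → *-monoˡ-≤ (g i)
                                                       (sum-𝟙≤1 (λ s → c s ≟F i) λ p r → inj (trans p (sym r)))) ⟩
    sum (λ i → 1 * g i)                            ≡⟨ sum-cong-≗ (λ i → *-identityˡ (g i)) ⟩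
    sum g ∎
    where open ≤-Reasoning

  count-enum : ∀ {k n p} {P : Fin n → Set p} (P? : ∀ j → Dec (P j)) (f : Fin k → Fin n) → Inj f →
    (∀ s → P (f s)) → (∀ j → P j → ∃ λ s → f s ≡ j) → sum (λ j → 𝟙 (P? j)) ≡ k
  count-enum {k} P? f inj hit onto = begin
    sum (λ j → 𝟙 (P? j))                       ≡⟨ sum-cong-≗ pt ⟨
    sum (λ j → sum (λ s → 𝟙 (f s ≟F j)))       ≡⟨ ∑-comm (λ j s → 𝟙 (f s ≟F j)) ⟩
    sum (λ s → sum (λ j → 𝟙 (f s ≟F j)))       ≡⟨ sum-cong-≗ (λ s → sum-𝟙≟ (f s)) ⟩
    sum {k} (λ s → 1)                          ≡⟨ sum-const k 1 ⟩
    k * 1                                      ≡⟨ *-identityʳ k ⟩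
    k ∎
    where
    open ≡-Reasoning
    pt : ∀ j → sum (λ s → 𝟙 (f s ≟F j)) ≡ 𝟙 (P? j)
    pt j with P? j
    ... | no ¬p = sum-0 λ s → 𝟙-no (f s ≟F j) λ eq → ¬p (subst _ eq (hit s))
    ... | yes p with onto j p
    ...   | s , refl = trans (sum-single _ s λ t t≢s → 𝟙-no (f t ≟F f s) (t≢s ∘ inj)) (𝟙-yes (f s ≟F f s) refl)

  -- In the application the rows are the vertices of Γ and the columns the generators of the other family.
  record Incidence (q m n : ℕ) (adj : Fin m → Fin n → Set) : Set where
    Φ : ℕ
    Φ = 1 + q * ((1 + q) * (1 + q * q))
    field
      adj? : ∀ i j → Dec (adj i j)
    a : Fin m → Fin n → ℕ
    a i j = 𝟙 (adj? i j)
    field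
      row-degree : ∀ i → sum (a i) ≡ Φ
      column-degree : ∀ {i j} → adj i j → sum (λ i′ → a i′ j) ≡ Φ
      row-common : ∀ {i i′ j} → i ≢ i′ → adj i j → adj i′ j → sum (λ j → a i j * a i′ j) ≡ suc q
      column-common : ∀ {j j′ i} → j ≢ j′ → adj i j → adj i j′ → sum (λ i → a i j * a i j′) ≡ suc q
    Collinear : Fin m → Fin m → Set
    Collinear i i′ = ∃ λ j → adj i j × adj i′ j
    field
      triangle : ∀ {i i′ i″} → i ≢ i′ → i ≢ i″ → i′ ≢ i″ →
        Collinear i i′ → Collinear i i″ → Collinear i′ i″ → ∃ λ j → adj i j × adj i′ j × adj i″ j

  -- Clique and coclique bounds for an incidence matrix.

  module _ (q m n : ℕ) (adj : Fin m → Fin n → Set) (I : Incidence q m n adj) where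
    open Incidence I

    a-yes : ∀ {i j} → adj i j → a i j ≡ 1
    a-yes {i} {j} = 𝟙-yes (adj? i j)

    weight-row-common : ∀ {i i′} (g : Fin n → ℕ) K → i ≢ i′ → Collinear i i′ →
      (∀ j → adj i j → adj i′ j → g j ≤ K) → sum (λ j → a i j * a i′ j * g j) ≤ suc q * K
    weight-row-common {i} {i′} g K i≢ (j₀ , p , r) h = begin
      sum (λ j → a i j * a i′ j * g j)   ≤⟨ sum-mono pt ⟩
      sum (λ j → a i j * a i′ j * K)     ≡⟨ *-distribʳ-sum K (λ j → a i j * a i′ j) ⟨
      sum (λ j → a i j * a i′ j) * K     ≡⟨ cong (_* K) (row-common i≢ p r) ⟩
      suc q * K ∎
      where
      open ≤-Reasoning
      pt : ∀ j → a i j * a i′ j * g j ≤ a i j * a i′ j * K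
      pt j with adj? i j | adj? i′ j
      ... | no _ | _ = z≤n
      ... | yes _ | no _ = z≤n
      ... | yes x | yes y = *-monoʳ-≤ 1 (h j x y)

    -- By `triangle`, the q + 1 common columns of two fixed members cover the whole clique. If no
    -- column meets every member, the covering argument can be repeated inside each of these
    -- columns, and this yields the cube.
    clique-bound : 2 ≤ q → ∀ {k} (c : Fin k → Fin m) → Inj c →
      (∀ {s t} → s ≢ t → Collinear (c s) (c t)) → k ≤ Φ
    clique-bound 2≤q {zero} c inj col = z≤n
    clique-bound 2≤q {suc zero} c inj col = s≤s z≤n
    clique-bound 2≤q {suc (suc k)} c inj col = go (any? λ j → all? λ s → adj? (c s) j)
      where
      open ≤-Reasoning
      N = suc (suc k)
      M = c zero
      y₀ = c (suc zero)

      card : N ≡ sum {N} (λ _ → 1)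
      card = sym (trans (sum-const N 1) (*-identityʳ N))

      -- The degenerate cases r = s and r = t are included so that the cover has no exceptional
      -- members.
      common : ∀ s t r → s ≢ t → ∃ λ j → adj (c s) j × adj (c t) j × adj (c r) j
      common s t r s≢t with r ≟F s
      ... | yes refl = let (j , x , y) = col s≢t in j , x , y , x
      ... | no r≢s with r ≟F t
      ...   | yes refl = let (j , x , y) = col s≢t in j , x , y , y
      ...   | no r≢t = triangle (s≢t ∘ inj) (r≢s ∘ sym ∘ inj) (r≢t ∘ sym ∘ inj)
                         (col s≢t) (col (r≢s ∘ sym)) (col (r≢t ∘ sym))

      cover : ∀ s t → s ≢ t → ∀ r → 1 ≤ sum (λ j → a (c s) j * a (c t) j * a (c r) j)
      cover s t s≢t r with common s t r s≢t
      ... | j , x , y , z = ≤-trans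
        (≤-reflexive (sym (cong₂ _*_ (cong₂ _*_ (a-yes x) (a-yes y)) (a-yes z))))
        (term≤sum (λ j → a (c s) j * a (c t) j * a (c r) j) j)

      swap-cover : ∀ s t (g : Fin N → ℕ) →
        sum (λ r → g r * sum (λ j → a (c s) j * a (c t) j * a (c r) j)) ≡
        sum (λ j → a (c s) j * a (c t) j * sum (λ r → g r * a (c r) j))
      swap-cover s t g = trans
        (sum-cong-≗ λ r → trans (*-distribˡ-sum (g r) (λ j → a (c s) j * a (c t) j * a (c r) j))
                        (sum-cong-≗ λ j → lem (g r) (a (c s) j * a (c t) j) (a (c r) j)))
        (trans (∑-comm (λ r j → a (c s) j * a (c t) j * (g r * a (c r) j)))
          (sum-cong-≗ λ j → sym (*-distribˡ-sum (a (c s) j * a (c t) j) (λ r → g r * a (c r) j))))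
        where
        lem : ∀ x y z → x * (y * z) ≡ y * (x * z)
        lem = solve-∀

      -- The weight `g` allows two uses of one covering: with constant weight for the whole clique,
      -- and with the indicator of a column for the members on that column.
      weighted-cover : ∀ s t → s ≢ t → (g : Fin N → ℕ) (K : ℕ) →
        (∀ j → adj (c s) j → adj (c t) j → sum (λ r → g r * a (c r) j) ≤ K) → sum g ≤ suc q * K
      weighted-cover s t s≢t g K h = begin
        sum g ≤⟨ sum-mono (λ r → ≤-trans (≤-reflexive (sym (*-identityʳ (g r)))) (*-monoʳ-≤ (g r) (cover s t s≢t r))) ⟩
        sum (λ r → g r * sum (λ j → a (c s) j * a (c t) j * a (c r) j)) ≡⟨ swap-cover s t g ⟩
        sum (λ j → a (c s) j * a (c t) j * sum (λ r → g r * a (c r) j))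
          ≤⟨ weight-row-common _ K (s≢t ∘ inj) (col s≢t) h ⟩
        suc q * K ∎

      -- The cube exceeds 1 + q + q² + q³ by 2q + 2q², which q⁴ absorbs because 2q ≤ q² and 3 ≤ q².
      arith : suc q * (suc q * suc q) ≤ Φ
      arith = begin
        suc q * (suc q * suc q)                             ≡⟨ e₁ q ⟩
        1 + (q + q * q + q * (q * q)) + (2 * q + 2 * (q * q)) ≤⟨ +-monoʳ-≤ (1 + (q + q * q + q * (q * q))) (begin
           2 * q + 2 * (q * q)     ≤⟨ +-monoˡ-≤ (2 * (q * q)) (*-monoˡ-≤ q 2≤q) ⟩
           q * q + 2 * (q * q)     ≡⟨ e₃ (q * q) ⟩
           3 * (q * q)             ≤⟨ *-monoˡ-≤ (q * q) (≤-trans (n≤1+n 3) (*-mono-≤ 2≤q 2≤q)) ⟩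
           q * q * (q * q) ∎) ⟩
        1 + (q + q * q + q * (q * q)) + q * q * (q * q)     ≡⟨ e₂ q ⟩
        Φ ∎
        where
        e₁ : ∀ q → suc q * (suc q * suc q) ≡ 1 + (q + q * q + q * (q * q)) + (2 * q + 2 * (q * q))
        e₁ = solve-∀
        e₂ : ∀ q → 1 + (q + q * q + q * (q * q)) + q * q * (q * q) ≡ 1 + q * ((1 + q) * (1 + q * q))
        e₂ = solve-∀
        e₃ : ∀ x → x + 2 * x ≡ 3 * x
        e₃ = solve-∀

      through-two : ∀ {j j′ i} → j ≢ j′ → adj i j → adj i j′ →
        sum (λ r → a (c r) j * a (c r) j′) ≤ suc q
      through-two {j} {j′} j≢ x y = ≤-trans (sum-inj-≤ c inj (λ i → a i j * a i j′)) (≤-reflexive (column-common j≢ x y))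

      go : Dec (∃ λ j → ∀ s → adj (c s) j) → N ≤ Φ
      go (yes (j , all-j)) = begin
        N                       ≡⟨ card ⟩
        sum {N} (λ _ → 1)       ≡⟨ sum-cong-≗ (λ s → a-yes (all-j s)) ⟨
        sum (λ s → a (c s) j)   ≤⟨ sum-inj-≤ c inj (λ i → a i j) ⟩
        sum (λ i → a i j)       ≡⟨ column-degree (all-j zero) ⟩
        Φ ∎
      go (no ¬center) = begin
        N                        ≡⟨ card ⟩
        sum {N} (λ _ → 1)        ≤⟨ weighted-cover zero (suc zero) (λ ()) (λ _ → 1) (suc q * suc q) through ⟩
        suc q * (suc q * suc q)  ≤⟨ arith ⟩
        Φ ∎
        where
        through : ∀ j → adj M j → adj y₀ j → sum (λ r → 1 * a (c r) j) ≤ suc q * suc q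
        through j Mj _ with any? (λ s → ¬? (adj? (c s) j))
        ... | no none = ⊥-elim (¬center (j , λ s → decidable-stable (adj? (c s) j) λ ¬p → none (s , ¬p)))
        -- Every member lies on a common column j′ of `M` and `z`. Since `z` is off j, each such j′
        -- differs from j, and two different columns share at most q + 1 members.
        ... | yes (z , ¬zj) =
          weighted-cover zero z (λ { refl → ¬zj Mj }) (λ r → 1 * a (c r) j) (suc q) λ j′ Mj′ zj′ →
            ≤-trans (≤-reflexive (sum-cong-≗ λ r → cong (_* a (c r) j′) (*-identityˡ (a (c r) j))))
              (through-two (λ { refl → ¬zj zj′ }) Mj Mj′)

    coclique-bound : 2 ≤ q → ∀ {l} (d : Fin l → Fin m) → Inj d →
      (∀ {s t} → s ≢ t → ¬ Collinear (d s) (d t)) → l * suc Φ ≤ m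
    -- Matching `s≤s` turns q into a successor: this makes ψ nonzero, so that it can be cancelled,
    -- and refutes `suc q ≡ 1` in `f≢Φ`.
    coclique-bound 2≤q@(s≤s _) {l} d inj ¬col = *-cancelʳ-≤ (l * suc Φ) m ψ final
      where
      open ≤-Reasoning
      ψ : ℕ
      ψ = q * ((1 + q) * (1 + q * q))

      -- Counts the walks of two steps from the coclique to x.
      f : Fin m → ℕ
      f x = sum λ s → sum λ j → a (d s) j * a x j

      δ : Fin m → ℕ
      δ x = sum λ s → 𝟙 (d s ≟F x)

      f-swap : ∀ x → f x ≡ sum λ j → sum (λ s → a (d s) j) * a x j
      f-swap x = trans (∑-comm (λ s j → a (d s) j * a x j))
        (sum-cong-≗ λ j → sym (*-distribʳ-sum (a x j) (λ s → a (d s) j)))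

      f≤Φ : ∀ x → f x ≤ Φ
      f≤Φ x = begin
        f x                                         ≡⟨ f-swap x ⟩
        sum (λ j → sum (λ s → a (d s) j) * a x j)   ≤⟨ sum-mono (λ j → *-monoˡ-≤ (a x j)
                                                        (sum-𝟙≤1 (λ s → adj? (d s) j) (uniq j))) ⟩
        sum (λ j → 1 * a x j)                       ≡⟨ sum-cong-≗ (λ j → *-identityˡ (a x j)) ⟩
        sum (a x)                                   ≡⟨ row-degree x ⟩
        Φ ∎
        where
        uniq : ∀ j {s t} → adj (d s) j → adj (d t) j → s ≡ t
        uniq j {s} {t} p r = decidable-stable (s ≟F t) λ s≢t → ¬col s≢t (j , p , r)

      f-divisible : ∀ x → (∀ s → d s ≢ x) → suc q ∣ f x
      f-divisible x off = go (λ s → d s) off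
        where
        go : ∀ {k} (d : Fin k → Fin m) → (∀ s → d s ≢ x) →
          suc q ∣ sum λ s → sum λ j → a (d s) j * a x j
        go {zero} d off = divides 0 refl
        go {suc k} d off with go (d ∘ suc) (off ∘ suc) | any? (λ j → adj? (d zero) j ×-dec adj? x j)
        ... | divides t eq | yes (j , p , r) = divides (suc t) (cong₂ _+_ (row-common (off zero) p r) eq)
        ... | divides t eq | no none = divides t (cong₂ _+_ (sum-0 zeros) eq)
          where
          zeros : ∀ j → a (d zero) j * a x j ≡ 0
          zeros j with adj? (d zero) j | adj? x j
          ... | no _ | _ = refl
          ... | yes _ | no _ = refl
          ... | yes p | yes r = ⊥-elim (none (j , p , r))

      f≢Φ : ∀ x → (∀ s → d s ≢ x) → f x ≢ Φ
      f≢Φ x off eq with ∣1⇒≡1 (∣m+n∣m⇒∣n {suc q} {ψ} {1} (subst (suc q ∣_) (trans eq (+-comm 1 ψ)) (f-divisible x off))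
                            (divides (q * (1 + q * q)) (e q)))
        where
        e : ∀ q → q * ((1 + q) * (1 + q * q)) ≡ q * (1 + q * q) * suc q
        e = solve-∀
      f≢Φ x off eq | ()

      -- Off the coclique divisibility excludes the value Φ and leaves at most ψ = Φ - 1; on it,
      -- `δ x` supplies the missing 1.
      f≤ : ∀ x → f x ≤ ψ + δ x
      f≤ x with any? (λ s → d s ≟F x)
      ... | yes (s , p) = ≤-trans (f≤Φ x) (≤-trans (≤-reflexive (+-comm 1 ψ)) (+-monoʳ-≤ ψ
            (≤-trans (≤-reflexive (sym (𝟙-yes (d s ≟F x) p))) (term≤sum (λ s → 𝟙 (d s ≟F x)) s))))
      ... | no none = ≤-trans (≤-pred (≤∧≢⇒< (f≤Φ x) (f≢Φ x λ s p → none (s , p)))) (m≤m+n ψ _)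

      total : sum f ≡ l * (Φ * Φ)
      total = begin-equality
        sum f                                                         ≡⟨ ∑-comm (λ x s → sum λ j → a (d s) j * a x j) ⟩
        sum (λ s → sum λ x → sum λ j → a (d s) j * a x j)             ≡⟨ sum-cong-≗ each ⟩
        sum {l} (λ s → Φ * Φ)                                         ≡⟨ sum-const l (Φ * Φ) ⟩
        l * (Φ * Φ) ∎
        where
        column : ∀ i j → sum (λ x → a i j * a x j) ≡ a i j * Φ
        column i j with adj? i j
        ... | no _ = sum-0 {m} λ _ → refl
        ... | yes p = trans (sum-cong-≗ λ x → *-identityˡ (a x j)) (trans (column-degree p) (sym (*-identityˡ Φ)))
        each : ∀ s → (sum λ x → sum λ j → a (d s) j * a x j) ≡ Φ * Φ
        each s = begin-equality
          (sum λ x → sum λ j → a (d s) j * a x j)  ≡⟨ ∑-comm (λ x j → a (d s) j * a x j) ⟩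
          (sum λ j → sum λ x → a (d s) j * a x j)  ≡⟨ sum-cong-≗ (column (d s)) ⟩
          (sum λ j → a (d s) j * Φ)                ≡⟨ *-distribʳ-sum Φ (a (d s)) ⟨
          sum (a (d s)) * Φ                        ≡⟨ cong (_* Φ) (row-degree (d s)) ⟩
          Φ * Φ ∎

      sum-δ : sum δ ≡ l
      sum-δ = trans (∑-comm (λ x s → 𝟙 (d s ≟F x)))
        (trans (sum-cong-≗ λ s → sum-𝟙≟ (d s)) (trans (sum-const l 1) (*-identityʳ l)))

      main : l * (Φ * Φ) ≤ m * ψ + l
      main = begin
        l * (Φ * Φ)             ≡⟨ total ⟨
        sum f                   ≤⟨ sum-mono f≤ ⟩
        sum (λ x → ψ + δ x)     ≡⟨ ∑-distrib-+ (λ _ → ψ) δ ⟩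
        sum {m} (λ _ → ψ) + sum δ ≡⟨ cong₂ _+_ (sum-const m ψ) sum-δ ⟩
        m * ψ + l ∎

      -- Moving the l contributed by the coclique itself to the other side turns Φ² into Φ² - 1 = (Φ
      -- + 1) ψ.
      final : l * suc Φ * ψ ≤ m * ψ
      final = +-cancelʳ-≤ l _ _ (≤-trans (≤-reflexive (e l ψ)) main)
        where
        e : ∀ l ψ → l * suc (1 + ψ) * ψ + l ≡ l * ((1 + ψ) * (1 + ψ))
        e = solve-∀

    separating : 2 ≤ q → 0 < m → ∀ {k l} (c : Fin k → Fin m) (d : Fin l → Fin m) → Inj c → Inj d →
      (∀ {s t} → s ≢ t → Collinear (c s) (c t)) → (∀ {s t} → s ≢ t → ¬ Collinear (d s) (d t)) → k * l < m
    -- The strict step l Φ < l (Φ + 1) below needs l > 0, so an empty coclique is settled by the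
    -- existence of a vertex.
    separating 2≤q 0<m {k} {zero} c d _ _ _ _ rewrite *-zeroʳ k = 0<m
    separating 2≤q 0<m {k} {l@(suc _)} c d ci di cc dd = begin-strict
      k * l      ≤⟨ *-monoˡ-≤ l (clique-bound 2≤q c ci cc) ⟩
      Φ * l      ≡⟨ *-comm Φ l ⟩
      l * Φ      <⟨ *-monoʳ-< l (n<1+n Φ) ⟩
      l * suc Φ  ≤⟨ coclique-bound 2≤q d di dd ⟩
      m ∎
      where open ≤-Reasoning

  𝟙-× : ∀ {P P′ : Set} (d : Dec P) (d′ : Dec P′) → 𝟙 d * 𝟙 d′ ≡ 𝟙 (d ×-dec d′)
  𝟙-× (yes _) (yes _) = refl
  𝟙-× (yes _) (no _) = refl
  𝟙-× (no _) _ = refl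

funToFin-cong : ∀ {m n} {f g : Fin m → Fin n} → (∀ i → f i ≡ g i) → funToFin f ≡ funToFin g
funToFin-cong {zero} h = ≡.refl
funToFin-cong {suc m} h = ≡.cong₂ combine (h zero) (funToFin-cong (h ∘ suc))

-- Linear algebra over the field with q elements.

module LinearAlgebra
  (R : CommutativeRing 0ℓ 0ℓ) (isField : Geometry.IsField R) (q : ℕ) (order : Geometry.HasOrder R q) where

  open CommutativeRing R renaming (Carrier to F; zero to *-zero)
  open Geometry R
  open import Algebra.Properties.Ring ring
    using (x∙y⁻¹≈ε⇒x≈y; -1*x≈-x; -‿injective; -0#≈0#)
  open import Relation.Binary.Reasoning.Setoid setoid

  e : Fin q → F
  e = proj₁ order

  index : F → Fin q
  index x = proj₁ (proj₁ (proj₂ order) x)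

  e-index : ∀ x → e (index x) ≈ x
  e-index x = proj₂ (proj₁ (proj₂ order) x)

  e-injective : ∀ {i j} → e i ≈ e j → i ≡ j
  e-injective = proj₂ (proj₂ order) _ _

  index-cong : ∀ {x y} → x ≈ y → index x ≡ index y
  index-cong x≈y = e-injective (trans (e-index _) (trans x≈y (sym (e-index _))))

  index-injective : ∀ {x y} → index x ≡ index y → x ≈ y
  index-injective eq = trans (sym (e-index _)) (trans (reflexive (≡.cong e eq)) (e-index _))

  infix 4 _≟_
  _≟_ : ∀ x y → Dec (x ≈ y)
  x ≟ y = map′ index-injective index-cong (index x Finₚ.≟ index y)

  1≉0 : ¬ (1# ≈ 0#)
  1≉0 = proj₁ isField

  inverse : ∀ {x} → ¬ (x ≈ 0#) → ∃ λ y → y * x ≈ 1#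
  inverse x≉0 = let (y , eq) = proj₂ isField _ x≉0 in y , trans (*-comm _ _) eq

  2≤q : 2 ≤ q
  2≤q = Finₚ.injective⇒≤ {f = f} f-injective
    where
    f : Fin 2 → Fin q
    f zero = index 0#
    f (suc zero) = index 1#
    f-injective : ∀ {i j} → f i ≡ f j → i ≡ j
    f-injective {zero} {zero} _ = ≡.refl
    f-injective {zero} {suc zero} eq = ⊥-elim (1≉0 (sym (index-injective eq)))
    f-injective {suc zero} {zero} eq = ⊥-elim (1≉0 (index-injective eq))
    f-injective {suc zero} {suc zero} _ = ≡.refl

  x+y-x≈y : ∀ x y → (x + y) - x ≈ y
  x+y-x≈y x y = begin
    (x + y) - x    ≈⟨ +-congʳ (+-comm x y) ⟩
    (y + x) - x    ≈⟨ +-assoc y x (- x) ⟩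
    y + (x - x)    ≈⟨ +-congˡ (-‿inverseʳ x) ⟩
    y + 0#         ≈⟨ +-identityʳ y ⟩
    y ∎

  x-y+y≈x : ∀ x y → (x - y) + y ≈ x
  x-y+y≈x x y = begin
    (x - y) + y    ≈⟨ +-assoc x (- y) y ⟩
    x + (- y + y)  ≈⟨ +-congˡ (-‿inverseˡ y) ⟩
    x + 0#         ≈⟨ +-identityʳ x ⟩
    x ∎

  interchange : ∀ a b c d → (a + b) + (c + d) ≈ (a + c) + (b + d)
  interchange a b c d = begin
    (a + b) + (c + d)  ≈⟨ +-assoc a b (c + d) ⟩
    a + (b + (c + d))  ≈⟨ +-congˡ (+-assoc b c d) ⟨
    a + ((b + c) + d)  ≈⟨ +-congˡ (+-congʳ (+-comm b c)) ⟩
    a + ((c + b) + d)  ≈⟨ +-congˡ (+-assoc c b d) ⟩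
    a + (c + (b + d))  ≈⟨ +-assoc a c (b + d) ⟨
    (a + c) + (b + d) ∎

  cancel-unit : ∀ {x y} z → y * x ≈ 1# → y * (x * z) ≈ z
  cancel-unit {x} {y} z eq = trans (sym (*-assoc y x z)) (trans (*-congʳ eq) (*-identityˡ z))

  -- Finite search

  ≈ᵥ-sym : ∀ {n} {u v : V n} → u ≈ᵥ v → v ≈ᵥ u
  ≈ᵥ-sym h j = sym (h j)

  ≈ᵥ-trans : ∀ {n} {u v w : V n} → u ≈ᵥ v → v ≈ᵥ w → u ≈ᵥ w
  ≈ᵥ-trans h g j = trans (h j) (g j)

  decode : ∀ {k} → Fin (q ℕ.^ k) → V k
  decode x i = e (finToFun x i)

  encode : ∀ {k} → V k → Fin (q ℕ.^ k)
  encode v = funToFin (λ i → index (v i))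

  decode-encode : ∀ {k} (v : V k) → decode (encode v) ≈ᵥ v
  decode-encode v i = trans (reflexive (≡.cong e (Finₚ.finToFun-funToFin (λ i → index (v i)) i))) (e-index (v i))

  decode-injective : ∀ {k} {x y : Fin (q ℕ.^ k)} → decode {k} x ≈ᵥ decode y → x ≡ y
  decode-injective {k} {x} {y} h = ≡.trans (≡.sym (Finₚ.funToFin-finToFin {k} x))
    (≡.trans (funToFin-cong (λ i → e-injective (h i))) (Finₚ.funToFin-finToFin {k} y))

  encode-injective : ∀ {k} {u v : V k} → encode u ≡ encode v → u ≈ᵥ v
  encode-injective {k} {u} {v} eq i = trans (sym (decode-encode u i))
    (trans (reflexive (≡.cong (λ x → decode {k} x i) eq)) (decode-encode v i))

  abstract
    -- `P` must respect `≈ᵥ` because a vector is recovered from its code only up to `≈ᵥ`.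
    search : ∀ {k} {P : V k → Set} → (∀ {u v} → u ≈ᵥ v → P u → P v) → (∀ v → Dec (P v)) → Dec (∃ P)
    search resp P? = map′ (λ { (x , p) → decode x , p })
      (λ { (v , p) → encode v , resp (≈ᵥ-sym (decode-encode v)) p })
      (Finₚ.any? (λ x → P? (decode x)))

  -- Comparing q^k with q^m takes the place of the exchange lemma: all dimension inequalities come
  -- from this cardinality argument, and `f` may be any injection, linear or not.
  injection⇒≤ : ∀ {k m} (f : V k → V m) → (∀ u v → f u ≈ᵥ f v → u ≈ᵥ v) → k ≤ m
  injection⇒≤ {k} {m} f inj = ℕₚ.≮⇒≥ λ m<k → ℕₚ.<⇒≱ (ℕₚ.^-monoʳ-< q 2≤q m<k) q^k≤q^m
    where
    q^k≤q^m : q ℕ.^ k ≤ q ℕ.^ m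
    q^k≤q^m = Finₚ.injective⇒≤ {f = λ x → encode (f (decode x))}
      λ eq → decode-injective (inj _ _ (encode-injective eq))

  -- Linear combinations and subspaces

  sumF-cong : ∀ {k} {f g : Fin k → F} → (∀ i → f i ≈ g i) → sumF f ≈ sumF g
  sumF-cong {zero} h = refl
  sumF-cong {suc k} h = +-cong (h zero) (sumF-cong (h ∘ suc))

  sumF-0 : ∀ {k} {f : Fin k → F} → (∀ i → f i ≈ 0#) → sumF f ≈ 0#
  sumF-0 {zero} h = refl
  sumF-0 {suc k} h = trans (+-cong (h zero) (sumF-0 (h ∘ suc))) (+-identityˡ 0#)

  sumF-+ : ∀ {k} (f g : Fin k → F) → sumF (λ i → f i + g i) ≈ sumF f + sumF g
  sumF-+ {zero} f g = sym (+-identityˡ 0#)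
  sumF-+ {suc k} f g = trans (+-congˡ (sumF-+ (f ∘ suc) (g ∘ suc))) (interchange _ _ _ _)

  sumF-* : ∀ {k} a (f : Fin k → F) → sumF (λ i → a * f i) ≈ a * sumF f
  sumF-* {zero} a f = sym (zeroʳ a)
  sumF-* {suc k} a f = trans (+-congˡ (sumF-* a (f ∘ suc))) (sym (distribˡ a _ _))

  lincomb-+ : ∀ {n k} (c d : V k) (b : Fin k → V n) → lincomb (c +ᵥ d) b ≈ᵥ (lincomb c b +ᵥ lincomb d b)
  lincomb-+ c d b j = trans (sumF-cong λ i → distribʳ (b i j) (c i) (d i)) (sumF-+ (λ i → c i * b i j) (λ i → d i * b i j))

  lincomb-· : ∀ {n k} a (c : V k) (b : Fin k → V n) → lincomb (a ·ᵥ c) b ≈ᵥ (a ·ᵥ lincomb c b)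
  lincomb-· a c b j = trans (sumF-cong λ i → *-assoc a (c i) (b i j)) (sumF-* a (λ i → c i * b i j))

  lincomb-cong : ∀ {n k} {c d : V k} (b : Fin k → V n) → c ≈ᵥ d → lincomb c b ≈ᵥ lincomb d b
  lincomb-cong b h j = sumF-cong λ i → *-congʳ (h i)

  record Subspace {n} (P : V n → Set) : Set where
    field
      resp : ∀ {u v} → u ≈ᵥ v → P u → P v
      0∈ : P 0ᵥ
      add : ∀ {u v} → P u → P v → P (u +ᵥ v)
      scale : ∀ {u} a → P u → P (a ·ᵥ u)

    lincomb∈ : ∀ {k} (c : V k) (b : Fin k → V n) → (∀ i → P (b i)) → P (lincomb c b)
    lincomb∈ {zero} c b h = 0∈
    lincomb∈ {suc k} c b h = add (scale (c zero) (h zero)) (lincomb∈ (c ∘ suc) (b ∘ suc) (h ∘ suc))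

    span⊆ : ∀ {k} {b : Fin k → V n} → (∀ i → P (b i)) → ∀ {v} → InSpan b v → P v
    span⊆ {b = b} h (c , v≈) = resp (≈ᵥ-sym v≈) (lincomb∈ c b h)

    cancel : ∀ {u v w} → w ≈ᵥ (u +ᵥ v) → P u → P w → P v
    cancel {u} {v} {w} w≈ pu pw = resp (λ j → begin
      w j + - 1# * u j        ≈⟨ +-cong (w≈ j) (-1*x≈-x (u j)) ⟩
      (u j + v j) - u j       ≈⟨ x+y-x≈y (u j) (v j) ⟩
      v j ∎) (add pw (scale (- 1#) pu))

    unscale : ∀ {a u} → ¬ (a ≈ 0#) → P (a ·ᵥ u) → P u
    unscale {a} {u} a≉0 p = let (b , ba) = inverse a≉0 in
      resp (λ j → cancel-unit (u j) ba) (scale b p)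

    remainder : ∀ {a u v w} → w ≈ᵥ (v +ᵥ (a ·ᵥ u)) → ¬ (a ≈ 0#) → P w → P v → P u
    remainder w≈ a≉0 pw pv = unscale a≉0 (cancel w≈ pv pw)

  open Subspace public

  span-subspace : ∀ {n k} (b : Fin k → V n) → Subspace (InSpan b)
  span-subspace b .resp u≈v (c , u≈) = c , ≈ᵥ-trans (≈ᵥ-sym u≈v) u≈
  span-subspace b .0∈ = 0ᵥ , λ j → sym (sumF-0 λ i → zeroˡ (b i j))
  span-subspace b .add (c , u≈) (d , v≈) = (c +ᵥ d) , λ j → trans (+-cong (u≈ j) (v≈ j)) (sym (lincomb-+ c d b j))
  span-subspace b .scale a (c , u≈) = (a ·ᵥ c) , λ j → trans (*-congˡ (u≈ j)) (sym (lincomb-· a c b j))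

  span-suc : ∀ {n k} (b : Fin (suc k) → V n) {v} → InSpan (b ∘ suc) v → InSpan b v
  span-suc b (c , v≈) = (0# ∷ c) , λ j → trans (v≈ j) (sym (trans (+-congʳ (zeroˡ (b zero j))) (+-identityˡ _)))

  span-zero : ∀ {n k} (b : Fin (suc k) → V n) → InSpan b (b zero)
  span-zero b = (1# ∷ 0ᵥ) , λ j → sym (trans (+-cong (*-identityˡ _) (sumF-0 λ i → zeroˡ (b (suc i) j))) (+-identityʳ _))

  basis∈span : ∀ {n k} (b : Fin k → V n) i → InSpan b (b i)
  basis∈span b zero = span-zero b
  basis∈span b (suc i) = span-suc b (basis∈span (b ∘ suc) i)

  ∩-subspace : ∀ {n} {P P′ : V n → Set} → Subspace P → Subspace P′ → Subspace (λ v → P v × P′ v)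
  ∩-subspace S T .resp h (x , y) = resp S h x , resp T h y
  ∩-subspace S T .0∈ = 0∈ S , 0∈ T
  ∩-subspace S T .add (x , y) (x′ , y′) = add S x x′ , add T y y′
  ∩-subspace S T .scale a (x , y) = scale S a x , scale T a y

  abstract
    inSpan? : ∀ {n k} (b : Fin k → V n) v → Dec (InSpan b v)
    inSpan? b v = search (λ c≈d v≈ → ≈ᵥ-trans v≈ (lincomb-cong b c≈d))
      (λ c → Finₚ.all? λ j → v j ≟ lincomb c b j)

  -- Independence and dimension

  lincomb-injective : ∀ {n k} (b : Fin k → V n) → LinIndep b → ∀ c d → lincomb c b ≈ᵥ lincomb d b → c ≈ᵥ d
  lincomb-injective b ind c d eq i = x∙y⁻¹≈ε⇒x≈y (c i) (d i) (trans (+-congˡ (sym (-1*x≈-x (d i)))) (ind (c +ᵥ ((- 1#) ·ᵥ d)) zeros i))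
    where
    zeros : lincomb (c +ᵥ ((- 1#) ·ᵥ d)) b ≈ᵥ 0ᵥ
    zeros j = begin
      lincomb (c +ᵥ ((- 1#) ·ᵥ d)) b j           ≈⟨ lincomb-+ c ((- 1#) ·ᵥ d) b j ⟩
      lincomb c b j + lincomb ((- 1#) ·ᵥ d) b j  ≈⟨ +-cong (eq j) (trans (lincomb-· (- 1#) d b j) (-1*x≈-x _)) ⟩
      lincomb d b j - lincomb d b j            ≈⟨ -‿inverseʳ _ ⟩
      0# ∎

  indep⇒≤ambient : ∀ {n k} (b : Fin k → V n) → LinIndep b → k ≤ n
  indep⇒≤ambient b ind = injection⇒≤ (λ c → lincomb c b) (lincomb-injective b ind)

  indep⇒≤span : ∀ {n k m} (b : Fin k → V n) (a : Fin m → V n) → LinIndep b → (∀ i → InSpan a (b i)) → k ≤ m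
  indep⇒≤span {k = k} b a ind h = injection⇒≤ (λ c → proj₁ (inA c)) λ c d eq →
    lincomb-injective b ind c d (≈ᵥ-trans (proj₂ (inA c)) (≈ᵥ-trans (lincomb-cong a eq) (≈ᵥ-sym (proj₂ (inA d)))))
    where
    inA : ∀ (c : V k) → InSpan a (lincomb c b)
    inA c = lincomb∈ (span-subspace a) c b h

  extend-indep : ∀ {n k} {b : Fin k → V n} {v} → LinIndep b → ¬ InSpan b v → LinIndep (v ∷ b)
  extend-indep {b = b} {v} ind v∉ c eq = coeffs
    where
    S = span-subspace b
    c₀≈0 : c zero ≈ 0#
    c₀≈0 = decidable-stable (c zero ≟ 0#) λ c₀≉0 → v∉ (unscale S c₀≉0
      (cancel S (λ j → trans (sym (eq j)) (+-comm _ _)) (c ∘ suc , λ _ → refl) (0∈ S)))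
    coeffs : ∀ i → c i ≈ 0#
    coeffs zero = c₀≈0
    coeffs (suc i) = ind (c ∘ suc) (λ j → begin
      lincomb (c ∘ suc) b j                        ≈⟨ +-identityˡ _ ⟨
      0# + lincomb (c ∘ suc) b j                   ≈⟨ +-congʳ (trans (*-congʳ c₀≈0) (zeroˡ (v j))) ⟨
      c zero * v j + lincomb (c ∘ suc) b j         ≈⟨ eq j ⟩
      0# ∎) i

  abstract
    -- A vector outside the span of `b` would give k + 1 independent vectors in the span of the k
    -- vectors `a`.
    full-indep-spans : ∀ {n k} {P : V n → Set} (b a : Fin k → V n) → LinIndep b → (∀ i → P (b i)) →
      (∀ {v} → P v → InSpan a v) → ∀ {v} → P v → InSpan b v
    full-indep-spans b a ind b∈ P⊆ {v} pv = decidable-stable (inSpan? b v) λ v∉ →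
      ℕₚ.1+n≰n (indep⇒≤span (v ∷ b) a (extend-indep ind v∉) (λ { zero → P⊆ pv ; (suc i) → P⊆ (b∈ i) }))

  hasDim-≤ : ∀ {n k l} {P P′ : V n → Set} → HasDim P k → HasDim P′ l → (∀ {v} → P v → P′ v) → k ≤ l
  hasDim-≤ (b , b∈ , ind , _) (a , _ , _ , sp) P⊆ = indep⇒≤span b a ind λ i → sp _ (P⊆ (b∈ i))

  hasDim-unique : ∀ {n k l} {P : V n → Set} → HasDim P k → HasDim P l → k ≡ l
  hasDim-unique h h′ = ℕₚ.≤-antisym (hasDim-≤ h h′ λ p → p) (hasDim-≤ h′ h λ p → p)

  hasDim-resp : ∀ {n k} {P P′ : V n → Set} → (∀ {v} → P v → P′ v) → (∀ {v} → P′ v → P v) → HasDim P k → HasDim P′ k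
  hasDim-resp to from (b , b∈ , ind , sp) = b , (λ i → to (b∈ i)) , ind , λ v p → sp v (from p)

  same-dim : ∀ {n k} {P P′ : V n → Set} → Subspace P → HasDim P k → HasDim P′ k → (∀ {v} → P v → P′ v) → ∀ {v} → P′ v → P v
  same-dim S (b , b∈ , ind , _) (a , _ , _ , sp) P⊆ p′ =
    span⊆ S b∈ (full-indep-spans b a ind (λ i → P⊆ (b∈ i)) (λ {v} → sp v) p′)

  abstract
    bounded-basis : ∀ {n} {P : V n → Set} → Subspace P → (∀ v → Dec (P v)) → ∃ λ k → HasDim P k
    bounded-basis {n} {P} S P? = grow n [] (λ ()) (λ _ _ ()) (ℕₚ.≤-reflexive (≡.sym (ℕₚ.+-identityʳ n)))
      where
      -- The invariant n ≤ fuel + k makes exhausted fuel contradictory: one more vector would give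
      -- more than n independent vectors in `V n`.
      grow : ∀ fuel {k} (b : Fin k → V n) → (∀ i → P (b i)) → LinIndep b → n ≤ fuel ℕ.+ k → ∃ λ k → HasDim P k
      grow fuel {k} b b∈ ind n≤
        with search {P = λ v → P v × ¬ InSpan b v} (λ u≈v (p , u∉) → resp S u≈v p , λ v∈ → u∉ (resp (span-subspace b) (≈ᵥ-sym u≈v) v∈))
               (λ v → P? v ×-dec ¬? (inSpan? b v))
      ... | no none = k , b , b∈ , ind , λ v p → decidable-stable (inSpan? b v) λ v∉ → none (v , p , v∉)
      grow zero b b∈ ind n≤ | yes (v , p , v∉) =
        ⊥-elim (ℕₚ.1+n≰n (ℕₚ.≤-trans (indep⇒≤ambient (v ∷ b) (extend-indep ind v∉)) n≤))
      grow (suc fuel) {k} b b∈ ind n≤ | yes (v , p , v∉) =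
        grow fuel (v ∷ b) (λ { zero → p ; (suc i) → b∈ i }) (extend-indep ind v∉)
          (ℕₚ.≤-trans n≤ (ℕₚ.≤-reflexive (≡.sym (ℕₚ.+-suc fuel k))))

  hyperplane-split : ∀ {n k} {P P′ : V n → Set} {w} → HasDim P k → HasDim P′ (suc k) → Subspace P →
    (∀ {v} → P v → P′ v) → P′ w → ¬ P w → ∀ {u} → P′ u → ∃ λ a → ∃ λ c → P a × u ≈ᵥ (a +ᵥ (c ·ᵥ w))
  hyperplane-split {w = w} (b , b∈ , ind , _) (a , _ , _ , sp) S P⊆ p′w ¬pw p′u
    with full-indep-spans (w ∷ b) a (extend-indep ind λ w∈ → ¬pw (span⊆ S b∈ w∈))
           (λ { zero → p′w ; (suc i) → P⊆ (b∈ i) }) (λ {v} → sp v) p′u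
  ... | c , u≈ = lincomb (c ∘ suc) b , c zero , lincomb∈ S (c ∘ suc) b b∈ , λ j → trans (u≈ j) (+-comm _ _)

  hyperplane-dim : ∀ {n k} {P P′ : V n → Set} {w} → HasDim P k → Subspace P → (∀ {v} → P v → P′ v) → P′ w → ¬ P w →
    (∀ {u} → P′ u → ∃ λ a → ∃ λ c → P a × u ≈ᵥ (a +ᵥ (c ·ᵥ w))) → HasDim P′ (suc k)
  hyperplane-dim {n} {P = P} {P′} {w} (b , b∈ , ind , sp) S P⊆ p′w ¬pw split =
    (w ∷ b) , (λ { zero → p′w ; (suc i) → P⊆ (b∈ i) }) , extend-indep ind (λ w∈ → ¬pw (span⊆ S b∈ w∈)) , spans
    where
    T = span-subspace (w ∷ b)
    spans : ∀ u → P′ u → InSpan (w ∷ b) u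
    spans u p′u = let (a , c , pa , u≈) = split p′u in
      resp T (≈ᵥ-sym u≈) (add T (span-suc (w ∷ b) (sp a pa)) (scale T c (span-zero (w ∷ b))))

  tail-indep : ∀ {n k} (b : Fin (suc k) → V n) → LinIndep b → LinIndep (b ∘ suc)
  tail-indep b ind c eq i = ind (0# ∷ c) (λ j → trans (+-congʳ (zeroˡ (b zero j))) (trans (+-identityˡ _) (eq j))) (suc i)

  head∉tail : ∀ {n k} (b : Fin (suc k) → V n) → LinIndep b → ¬ InSpan (b ∘ suc) (b zero)
  head∉tail b ind (c , b₀≈) = 1≉0 (-‿injective (trans (ind ((- 1#) ∷ c) zeros zero) (sym -0#≈0#)))
    where
    zeros : lincomb ((- 1#) ∷ c) b ≈ᵥ 0ᵥ
    zeros j = trans (+-cong (-1*x≈-x _) (sym (b₀≈ j))) (-‿inverseˡ _)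

  -- Representatives of the points of the projective space of V j, normalised to have first nonzero entry 1.

  #points : ℕ → ℕ
  #points zero = 0
  #points (suc j) = q ℕ.^ j ℕ.+ #points j

  normalised : ∀ j → Fin (q ℕ.^ j) ⊎ Fin (#points j) → V (suc j)
  point : ∀ j → Fin (#points j) → V j
  normalised j (inj₁ x) = 1# ∷ decode x
  normalised j (inj₂ p) = 0# ∷ point j p
  point (suc j) p = normalised j (splitAt (q ℕ.^ j) p)

  point-nonzero : ∀ j p → ∃ λ t → ¬ (point j p t ≈ 0#)
  point-nonzero (suc j) p with splitAt (q ℕ.^ j) p
  ... | inj₁ x = zero , 1≉0
  ... | inj₂ p′ = let (t , h) = point-nonzero j p′ in suc t , h

  point-injective : ∀ j p p′ a → point j p′ ≈ᵥ (a ·ᵥ point j p) → p ≡ p′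
  normalised-injective : ∀ j s s′ a → normalised j s′ ≈ᵥ (a ·ᵥ normalised j s) → s ≡ s′
  point-injective (suc j) p p′ a h = ≡.trans (≡.sym (Finₚ.join-splitAt (q ℕ.^ j) (#points j) p))
    (≡.trans (≡.cong (join (q ℕ.^ j) (#points j)) (normalised-injective j (splitAt (q ℕ.^ j) p) (splitAt (q ℕ.^ j) p′) a h))
      (Finₚ.join-splitAt (q ℕ.^ j) (#points j) p′))
  normalised-injective j (inj₁ x) (inj₁ x′) a h = ≡.cong inj₁ (decode-injective {j} λ i → sym (begin
    decode x′ i      ≈⟨ h (suc i) ⟩
    a * decode x i   ≈⟨ *-congʳ (trans (h zero) (*-identityʳ a)) ⟨
    1# * decode x i  ≈⟨ *-identityˡ _ ⟩
    decode x i ∎))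
  normalised-injective j (inj₁ x) (inj₂ p′) a h = let (t , nz) = point-nonzero j p′ in
    ⊥-elim (nz (trans (h (suc t)) (trans (*-congʳ (sym (trans (h zero) (*-identityʳ a)))) (zeroˡ _))))
  normalised-injective j (inj₂ p) (inj₁ x′) a h = ⊥-elim (1≉0 (trans (h zero) (zeroʳ a)))
  normalised-injective j (inj₂ p) (inj₂ p′) a h = ≡.cong inj₂ (point-injective j p p′ a (h ∘ suc))

  normalise : ∀ j (c : V j) → ¬ (c ≈ᵥ 0ᵥ) → ∃ λ p → ∃ λ a → ¬ (a ≈ 0#) × c ≈ᵥ (a ·ᵥ point j p)
  normalise zero c c≉ = ⊥-elim (c≉ λ ())
  normalise (suc j) c c≉ = go (c zero ≟ 0#)
    where
    Goal : Set
    Goal = ∃ λ p → ∃ λ a → ¬ (a ≈ 0#) × c ≈ᵥ (a ·ᵥ point (suc j) p)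

    fromNormalised : ∀ s a → ¬ (a ≈ 0#) → c ≈ᵥ (a ·ᵥ normalised j s) → Goal
    fromNormalised s a a≉0 h = join (q ℕ.^ j) (#points j) s , a , a≉0 , λ i → trans (h i)
      (*-congˡ (reflexive (≡.cong (λ s → normalised j s i) (≡.sym (Finₚ.splitAt-join (q ℕ.^ j) (#points j) s)))))

    go : Dec (c zero ≈ 0#) → Goal
    go (no c₀≉0) = let (y , eq) = inverse c₀≉0 in
      fromNormalised (inj₁ (encode (y ·ᵥ (c ∘ suc)))) (c zero) c₀≉0 λ
        { zero → sym (*-identityʳ _)
        ; (suc i) → sym (trans (*-congˡ (decode-encode (y ·ᵥ (c ∘ suc)) i))
                               (cancel-unit _ (trans (*-comm _ _) eq))) }
    go (yes c₀≈0) with normalise j (c ∘ suc) (λ h → c≉ λ { zero → c₀≈0 ; (suc i) → h i })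
    ... | p , a , a≉0 , h = fromNormalised (inj₂ p) a a≉0 λ { zero → trans c₀≈0 (sym (zeroʳ a)) ; (suc i) → h i }

-- Nondegenerate quadratic forms: separation and interpolation.

module QuadraticSpace
  (R : CommutativeRing 0ℓ 0ℓ) (isField : Geometry.IsField R) (q : ℕ) (order : Geometry.HasOrder R q)
  (n : ℕ) (Q : Geometry.V R n → CommutativeRing.Carrier R)
  (isQuadratic : Geometry.IsQuadraticForm R Q) (nondegenerate : Geometry.Nondegenerate R Q) where

  open CommutativeRing R renaming (Carrier to F; zero to *-zero)
  open Geometry R
  open LinearAlgebra R isField q order
  open import Algebra.Properties.Ring ring using (-‿distribˡ-*)
  open import Relation.Binary.Reasoning.Setoid setoid

  B : V n → V n → F
  B = polar Q

  Q-cong : ∀ {u v} → u ≈ᵥ v → Q u ≈ Q v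
  Q-cong = proj₁ isQuadratic _ _

  Q-scale : ∀ a v → Q (a ·ᵥ v) ≈ a * a * Q v
  Q-scale = proj₁ (proj₂ isQuadratic)

  B-addˡ : ∀ u v w → B (u +ᵥ v) w ≈ B u w + B v w
  B-addˡ = proj₁ (proj₂ (proj₂ isQuadratic))

  B-scaleˡ : ∀ a u w → B (a ·ᵥ u) w ≈ a * B u w
  B-scaleˡ = proj₂ (proj₂ (proj₂ isQuadratic))

  B-cong : ∀ {u u′ v v′} → u ≈ᵥ u′ → v ≈ᵥ v′ → B u v ≈ B u′ v′
  B-cong h g = +-cong (+-cong (Q-cong λ j → +-cong (h j) (g j)) (-‿cong (Q-cong h))) (-‿cong (Q-cong g))

  B-sym : ∀ u v → B u v ≈ B v u
  B-sym u v = begin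
    (Q (u +ᵥ v) - Q u) - Q v  ≈⟨ +-assoc _ _ _ ⟩
    Q (u +ᵥ v) + (- Q u - Q v)  ≈⟨ +-cong (Q-cong λ j → +-comm (u j) (v j)) (+-comm _ _) ⟩
    Q (v +ᵥ u) + (- Q v - Q u)  ≈⟨ +-assoc _ _ _ ⟨
    (Q (v +ᵥ u) - Q v) - Q u ∎

  B-addʳ : ∀ u v w → B u (v +ᵥ w) ≈ B u v + B u w
  B-addʳ u v w = trans (B-sym u (v +ᵥ w)) (trans (B-addˡ v w u) (+-cong (B-sym v u) (B-sym w u)))

  B-scaleʳ : ∀ a u v → B u (a ·ᵥ v) ≈ a * B u v
  B-scaleʳ a u v = trans (B-sym u (a ·ᵥ v)) (trans (B-scaleˡ a v u) (*-congˡ (B-sym v u)))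

  Q-+ : ∀ u v → Q (u +ᵥ v) ≈ (Q u + Q v) + B u v
  Q-+ u v = sym (begin
    (Q u + Q v) + ((Q (u +ᵥ v) - Q u) - Q v)    ≈⟨ +-comm _ _ ⟩
    ((Q (u +ᵥ v) - Q u) - Q v) + (Q u + Q v)    ≈⟨ +-congˡ (+-comm _ _) ⟩
    ((Q (u +ᵥ v) - Q u) - Q v) + (Q v + Q u)    ≈⟨ +-assoc _ _ _ ⟨
    (((Q (u +ᵥ v) - Q u) - Q v) + Q v) + Q u    ≈⟨ +-congʳ (x-y+y≈x _ _) ⟩
    (Q (u +ᵥ v) - Q u) + Q u                    ≈⟨ x-y+y≈x _ _ ⟩
    Q (u +ᵥ v) ∎)

  ⊥-singular : ∀ {u v} → Q u ≈ 0# → Q v ≈ 0# → Q (u +ᵥ v) ≈ 0# → B u v ≈ 0#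
  ⊥-singular {u} {v} Qu Qv Quv = begin
    (Q (u +ᵥ v) - Q u) - Q v  ≈⟨ +-cong (+-cong Quv (-‿cong Qu)) (-‿cong Qv) ⟩
    (0# - 0#) - 0#            ≈⟨ +-congʳ (-‿inverseʳ 0#) ⟩
    0# - 0#                   ≈⟨ -‿inverseʳ 0# ⟩
    0# ∎

  singular-+ : ∀ {u v} → Q u ≈ 0# → Q v ≈ 0# → B u v ≈ 0# → Q (u +ᵥ v) ≈ 0#
  singular-+ {u} {v} Qu Qv Buv = trans (Q-+ u v)
    (trans (+-cong (trans (+-cong Qu Qv) (+-identityˡ 0#)) Buv) (+-identityˡ 0#))

  singular-· : ∀ a {u} → Q u ≈ 0# → Q (a ·ᵥ u) ≈ 0#
  singular-· a {u} Qu = trans (Q-scale a u) (trans (*-congˡ Qu) (zeroʳ _))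

  perpˡ : ∀ w → Subspace (λ v → B v w ≈ 0#)
  perpˡ w .resp h p = trans (B-cong (≈ᵥ-sym h) (λ _ → refl)) p
  perpˡ w .0∈ = trans (trans (B-cong {v = w} (λ j → sym (zeroˡ 0#)) (λ _ → refl)) (B-scaleˡ 0# 0ᵥ w)) (zeroˡ _)
  perpˡ w .add p r = trans (B-addˡ _ _ w) (trans (+-cong p r) (+-identityˡ 0#))
  perpˡ w .scale a p = trans (B-scaleˡ a _ w) (trans (*-congˡ p) (zeroʳ a))

  perpʳ : ∀ u → Subspace (λ v → B u v ≈ 0#)
  perpʳ u .resp {v} {v′} h p = trans (B-sym u v′) (resp (perpˡ u) h (trans (B-sym v u) p))
  perpʳ u .0∈ = trans (B-sym u 0ᵥ) (0∈ (perpˡ u))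
  perpʳ u .add p r = trans (B-addʳ u _ _) (trans (+-cong p r) (+-identityˡ 0#))
  perpʳ u .scale a p = trans (B-scaleʳ a u _) (trans (*-congˡ p) (zeroʳ a))

  abstract
    -- The usable form of nondegeneracy, by elimination of `b zero`. If w₀ is orthogonal to the tail
    -- and pairs to 1 with `b zero`, then v - B(v, w₀) b₀ is still outside the span of the tail; a
    -- w′ that separates it is corrected by a multiple of w₀ to become orthogonal to b₀. The case
    -- split on `b zero` lets `b` be dependent, as concatenated bases of two generators may be.
    separate : ∀ {k} (b : Fin k → V n) {v} → ¬ InSpan b v → ∃ λ w → (∀ i → B (b i) w ≈ 0#) × B v w ≈ 1#
    separate {zero} b {v} v∉
      with search {P = λ w → ¬ (B v w ≈ 0#)} (λ h ne eq → ne (resp (perpʳ v) (≈ᵥ-sym h) eq)) (λ w → ¬? (B v w ≟ 0#))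
    ... | no none = ⊥-elim (v∉ ((λ ()) , nondegenerate v λ w → decidable-stable (B v w ≟ 0#) λ ne → none (w , ne)))
    ... | yes (w , ne) = let (y , eq) = inverse ne in (y ·ᵥ w) , (λ ()) , trans (B-scaleʳ y v w) eq
    separate {suc k} b {v} v∉ with inSpan? (b ∘ suc) (b zero)
    ... | yes b₀∈ = let (w , b⊥w , vw) = separate (b ∘ suc) (v∉ ∘ span-suc b) in
      w , (λ { zero → span⊆ (perpˡ w) b⊥w b₀∈ ; (suc i) → b⊥w i }) , vw
    ... | no b₀∉ with separate (b ∘ suc) b₀∉
    ...   | w₀ , b⊥w₀ , b₀w₀ with separate (b ∘ suc) {v +ᵥ ((- B v w₀) ·ᵥ b zero)} reduced∉
      where
      reduced∉ : ¬ InSpan (b ∘ suc) (v +ᵥ ((- B v w₀) ·ᵥ b zero))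
      reduced∉ v′∈ = v∉ (resp S (λ j → trans (+-assoc _ _ _)
        (trans (+-congˡ (trans (sym (distribʳ _ _ _)) (trans (*-congʳ (-‿inverseˡ _)) (zeroˡ _)))) (+-identityʳ _)))
        (add S (span-suc b v′∈) (scale S (B v w₀) (span-zero b))))
        where
        S : Subspace (InSpan b)
        S = span-subspace b
    ...     | w′ , b⊥w′ , v′w′ = w , b⊥w , vw
      where
      c : F
      c = - B (b zero) w′
      w : V n
      w = w′ +ᵥ (c ·ᵥ w₀)
      B-w : ∀ u → B u w ≈ B u w′ + c * B u w₀
      B-w u = trans (B-addʳ u _ _) (+-congˡ (B-scaleʳ c u w₀))
      b⊥w : ∀ i → B (b i) w ≈ 0#
      b⊥w zero = trans (B-w _) (trans (+-congˡ (trans (*-congˡ b₀w₀) (*-identityʳ c))) (-‿inverseʳ _))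
      b⊥w (suc i) = trans (B-w _) (trans (+-cong (b⊥w′ i) (trans (*-congˡ (b⊥w₀ i)) (zeroʳ c))) (+-identityˡ 0#))
      vw : B v w ≈ 1#
      vw = begin
        B v w                                              ≈⟨ B-w v ⟩
        B v w′ + - B (b zero) w′ * B v w₀                  ≈⟨ +-congˡ (trans (sym (-‿distribˡ-* _ _)) (trans (-‿cong (*-comm _ _)) (-‿distribˡ-* _ _))) ⟩
        B v w′ + - B v w₀ * B (b zero) w′                  ≈⟨ +-congˡ (B-scaleˡ _ _ _) ⟨
        B v w′ + B ((- B v w₀) ·ᵥ b zero) w′               ≈⟨ B-addˡ _ _ _ ⟨
        B (v +ᵥ ((- B v w₀) ·ᵥ b zero)) w′                 ≈⟨ v′w′ ⟩
        1# ∎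

  -- Each round trades the head of `b` for a vector w that is orthogonal to the tail and pairs to 1
  -- with the head. The head is orthogonal to all of `u` but not to w, so w enlarges `u`
  -- independently; in the end k + l independent vectors sit in `V n`.
  orthogonal-≤ : ∀ {k l} (b : Fin k → V n) (u : Fin l → V n) → LinIndep b → LinIndep u →
    (∀ i j → B (b i) (u j) ≈ 0#) → k ℕ.+ l ≤ n
  orthogonal-≤ {zero} b u ib iu _ = indep⇒≤ambient u iu
  orthogonal-≤ {suc k} {l} b u ib iu b⊥u with separate (b ∘ suc) (head∉tail b ib)
  ... | w , b⊥w , b₀w = ≡.subst (_≤ n) (ℕₚ.+-suc k l)
    (orthogonal-≤ (b ∘ suc) (w ∷ u) (tail-indep b ib)
      (extend-indep iu λ w∈ → 1≉0 (trans (sym b₀w) (span⊆ (perpʳ (b zero)) (b⊥u zero) w∈)))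
      λ { i zero → b⊥w i ; i (suc j) → b⊥u (suc i) j })

  abstract
    interpolate : ∀ {k} (b : Fin k → V n) → LinIndep b → ∀ (c : V k) → ∃ λ v → ∀ i → B (b i) v ≈ c i
    interpolate {zero} b ib c = 0ᵥ , λ ()
    interpolate {suc k} b ib c with separate (b ∘ suc) (head∉tail b ib) | interpolate (b ∘ suc) (tail-indep b ib) (c ∘ suc)
    ... | w , b⊥w , b₀w | v , bv = v +ᵥ (a ·ᵥ w) , λ i → trans (trans (B-addʳ (b i) _ _) (+-congˡ (B-scaleʳ a _ _))) (values i)
      where
      a : F
      a = c zero - B (b zero) v
      values : ∀ i → B (b i) v + a * B (b i) w ≈ c i
      values zero = trans (+-congˡ (trans (*-congˡ b₀w) (*-identityʳ a))) (trans (+-comm _ _) (x-y+y≈x _ _))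
      values (suc i) = trans (+-cong (bv i) (trans (*-congˡ (b⊥w i)) (zeroʳ a))) (+-identityʳ _)

  -- Correcting a solution of B (b i) v = c i by a multiple of a singular b t with c t ≠ 0 makes it singular.
  abstract
    interpolate-singular : ∀ {k} (b : Fin k → V n) → LinIndep b → TotallySingular Q b →
      ∀ (c : V k) t → ¬ (c t ≈ 0#) → ∃ λ v → Q v ≈ 0# × (∀ i → B (b i) v ≈ c i)
    interpolate-singular b ib ts c t ct≉0 with interpolate b ib c | inverse ct≉0
    ... | s , bs | y , y-inv = v , Qv , bv
      where
      a : F
      a = - Q s * y
      v : V n
      v = s +ᵥ (a ·ᵥ b t)
      Qb : ∀ i → Q (b i) ≈ 0#
      Qb i = ts (b i) (basis∈span b i)
      Qv : Q v ≈ 0#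
      Qv = begin
        Q v                                        ≈⟨ Q-+ s (a ·ᵥ b t) ⟩
        (Q s + Q (a ·ᵥ b t)) + B s (a ·ᵥ b t)      ≈⟨ +-cong (trans (+-congˡ (singular-· a (Qb t))) (+-identityʳ _)) (B-scaleʳ a s (b t)) ⟩
        Q s + a * B s (b t)                        ≈⟨ +-congˡ (*-congˡ (trans (B-sym s (b t)) (bs t))) ⟩
        Q s + - Q s * y * c t                      ≈⟨ +-congˡ (trans (*-assoc _ _ _) (trans (*-congˡ y-inv) (*-identityʳ _))) ⟩
        Q s - Q s                                  ≈⟨ -‿inverseʳ _ ⟩
        0# ∎
      bv : ∀ i → B (b i) v ≈ c i
      bv i = trans (B-addʳ (b i) _ _) (trans (+-cong (bs i) (trans (B-scaleʳ a _ _)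
        (trans (*-congˡ (⊥-singular (Qb i) (Qb t) (ts _ (add (span-subspace b) (basis∈span b i) (basis∈span b t))))) (zeroʳ a)))) (+-identityʳ _))

-- Generators have dimension r, the largest possible in dimension n ≤ 2 r; the theorem is the case r = 5, n = 10, t = 3.
module DualPolar
  (R : CommutativeRing 0ℓ 0ℓ) (isField : Geometry.IsField R) (q : ℕ) (order : Geometry.HasOrder R q)
  (n r t : ℕ) (n≤r+r : n ≤ r ℕ.+ r) (r≡2+t : r ≡ suc (suc t)) (Q : Geometry.V R n → CommutativeRing.Carrier R)
  (isQuadratic : Geometry.IsQuadraticForm R Q) (nondegenerate : Geometry.Nondegenerate R Q) where

  open CommutativeRing R renaming (Carrier to F; zero to *-zero)
  open Geometry R
  open LinearAlgebra R isField q order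
  open import Algebra.Properties.Ring ring using (-‿distribˡ-*; -1*x≈-x; x∙y⁻¹≈ε⇒x≈y)
  open QuadraticSpace R isField q order n Q isQuadratic nondegenerate

  -- Generators, their perpendicular spaces and their intersections.

  Generator : Set
  Generator = Σ (Fin r → V n) (TSSubspace Q r)

  infix 4 _∈_ _∈?_
  _∈_ : V n → Generator → Set
  v ∈ M = InSpan (proj₁ M) v

  _∈?_ : ∀ v M → Dec (v ∈ M)
  v ∈? M = inSpan? (proj₁ M) v

  gen-subspace : ∀ M → Subspace (_∈ M)
  gen-subspace M = span-subspace (proj₁ M)

  infix 5 _∩_
  _∩_ : Generator → Generator → V n → Set
  (M ∩ N) v = v ∈ M × v ∈ N

  meet-subspace : ∀ M N → Subspace (M ∩ N)
  meet-subspace M N = ∩-subspace (gen-subspace M) (gen-subspace N)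

  ∩-comm : ∀ {k} M N → HasDim (M ∩ N) k → HasDim (N ∩ M) k
  ∩-comm M N = hasDim-resp swap swap

  gen-dim : ∀ M → HasDim (_∈ M) r
  gen-dim M = proj₁ M , basis∈span (proj₁ M) , proj₁ (proj₂ M) , λ v v∈ → v∈

  gen-dim′ : ∀ M → HasDim (_∈ M) (2 ℕ.+ t)
  gen-dim′ M = ≡.subst (HasDim (_∈ M)) r≡2+t (gen-dim M)

  singular : ∀ M {v} → v ∈ M → Q v ≈ 0#
  singular M = proj₂ (proj₂ M) _

  isotropic : ∀ M {u v} → u ∈ M → v ∈ M → B u v ≈ 0#
  isotropic M u∈ v∈ = ⊥-singular (singular M u∈) (singular M v∈) (singular M (add (gen-subspace M) u∈ v∈))

  -- A vector v outside M would make `v ∷ b` and `b` orthogonal independent families of total size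
  -- 2r + 1 > n. Singularity of v is not assumed but follows.
  perp⊆ : ∀ M {v} → (∀ {u} → u ∈ M → B u v ≈ 0#) → v ∈ M
  perp⊆ M@(b , ib , _) {v} M⊥v = decidable-stable (v ∈? M) λ v∉ →
    ℕₚ.<⇒≱ (s≤s n≤r+r) (orthogonal-≤ (v ∷ b) b (extend-indep ib v∉) ib
      λ { zero j → trans (B-sym v (b j)) (M⊥v (basis∈span b j))
        ; (suc i) j → isotropic M {b i} {b j} (basis∈span b i) (basis∈span b j) })

  -- (M ∩ N)^⊥ ⊆ M^⊥ + N^⊥ = M + N
  abstract
    meet-perp⊆ : ∀ M N {v} → (∀ {u} → u ∈ M → u ∈ N → B u v ≈ 0#) → ∃ λ a → ∃ λ b → a ∈ M × b ∈ N × v ≈ᵥ (a +ᵥ b)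
    meet-perp⊆ M N {v} h = span⊆ sum-subspace inSum (decidable-stable (inSpan? c v) absurd)
      where
      c : Fin (r ℕ.+ r) → V n
      c = proj₁ M ++ proj₁ N
      Sum : V n → Set
      Sum v = ∃ λ a → ∃ λ b → a ∈ M × b ∈ N × v ≈ᵥ (a +ᵥ b)
      sum-subspace : Subspace Sum
      sum-subspace .resp u≈v (a , b , a∈ , b∈ , u≈) = a , b , a∈ , b∈ , ≈ᵥ-trans (≈ᵥ-sym u≈v) u≈
      sum-subspace .0∈ = 0ᵥ , 0ᵥ , 0∈ (gen-subspace M) , 0∈ (gen-subspace N) , λ j → sym (+-identityˡ 0#)
      sum-subspace .add (a , b , a∈ , b∈ , u≈) (a′ , b′ , a′∈ , b′∈ , v≈) = (a +ᵥ a′) , (b +ᵥ b′) ,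
        add (gen-subspace M) a∈ a′∈ , add (gen-subspace N) b∈ b′∈ , λ j → trans (+-cong (u≈ j) (v≈ j)) (interchange _ _ _ _)
      sum-subspace .scale x (a , b , a∈ , b∈ , u≈) = (x ·ᵥ a) , (x ·ᵥ b) ,
        scale (gen-subspace M) x a∈ , scale (gen-subspace N) x b∈ , λ j → trans (*-congˡ (u≈ j)) (distribˡ x _ _)
      inSum : ∀ i → Sum (c i)
      inSum i with splitAt r i
      ... | inj₁ k = proj₁ M k , 0ᵥ , basis∈span (proj₁ M) k , 0∈ (gen-subspace N) , λ j → sym (+-identityʳ _)
      ... | inj₂ k = 0ᵥ , proj₁ N k , 0∈ (gen-subspace M) , basis∈span (proj₁ N) k , λ j → sym (+-identityˡ _)
      -- A vector w orthogonal to M + N lies in M and in N by `perp⊆`, so the hypothesis gives B(v,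
      -- w) = 0, against the value 1.
      absurd : ¬ ¬ InSpan c v
      absurd v∉ with separate c v∉
      ... | w , c⊥w , vw = 1≉0 (trans (sym vw) (trans (B-sym v w) (h
        (perp⊆ M (span⊆ (perpˡ w) λ i → ≡.subst (λ u → B u w ≈ 0#) (lookup-++ˡ (proj₁ M) (proj₁ N) i) (c⊥w (i ↑ˡ r))))
        (perp⊆ N (span⊆ (perpˡ w) λ i → ≡.subst (λ u → B u w ≈ 0#) (lookup-++ʳ (proj₁ M) (proj₁ N) i) (c⊥w (r ↑ʳ i)))))))

  Same : Generator → Generator → Set
  Same M N = ∀ v → (v ∈ M → v ∈ N) × (v ∈ N → v ∈ M)

  Same-sym : ∀ {M N} → Same M N → Same N M
  Same-sym h v = swap (h v)

  Same-trans : ∀ {M N K} → Same M N → Same N K → Same M K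
  Same-trans h g v = proj₁ (g v) ∘ proj₁ (h v) , proj₂ (h v) ∘ proj₂ (g v)

  ⊆⇒Same : ∀ M N → (∀ {v} → v ∈ M → v ∈ N) → Same M N
  ⊆⇒Same M N M⊆N v = M⊆N , same-dim (gen-subspace M) (gen-dim M) (gen-dim N) M⊆N

  abstract
    Same? : ∀ M N → Dec (Same M N)
    Same? M N = map′ (λ h → ⊆⇒Same M N (span⊆ (gen-subspace N) h)) (λ h i → proj₁ (h _) (basis∈span (proj₁ M) i))
      (Finₚ.all? λ i → proj₁ M i ∈? N)

  meet-dim-resp : ∀ {k} M M′ N N′ → Same M M′ → Same N N′ → HasDim (M ∩ N) k → HasDim (M′ ∩ N′) k
  meet-dim-resp M M′ N N′ h g = hasDim-resp (λ (x , y) → proj₁ (h _) x , proj₁ (g _) y) (λ (x , y) → proj₂ (h _) x , proj₂ (g _) y)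

  abstract
    meet-dim : ∀ M N → ∃ λ k → HasDim (M ∩ N) k
    meet-dim M N = bounded-basis (meet-subspace M N) λ v → (v ∈? M) ×-dec (v ∈? N)

  meet-dim? : ∀ k M N → Dec (HasDim (M ∩ N) k)
  meet-dim? k M N = let (l , d) = meet-dim M N in
    map′ (λ { ≡.refl → d }) (hasDim-unique d) (l ℕₚ.≟ k)

  Same⇒full-dim : ∀ M N → Same M N → HasDim (M ∩ N) (2 ℕ.+ t)
  Same⇒full-dim M N h = hasDim-resp (λ v∈ → v∈ , proj₁ (h _) v∈) proj₁ (gen-dim′ M)

  full-dim⇒Same : ∀ M N → HasDim (M ∩ N) (2 ℕ.+ t) → Same M N
  full-dim⇒Same M N d = ⊆⇒Same M N λ v∈ → proj₂ (same-dim (meet-subspace M N) d (gen-dim′ M) proj₁ v∈)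

  escape : ∀ {k l} {P P′ : V n → Set} → HasDim P k → Subspace P → (∀ v → Dec (P v)) → HasDim P′ l → k < l →
    ∃ λ v → P′ v × ¬ P v
  escape {P = P} {P′} d S P? d′@(b , b∈ , _ , sp) k<l = go (Finₚ.any? λ i → ¬? (P? (b i)))
    where
    go : Dec (∃ λ i → ¬ P (b i)) → ∃ λ v → P′ v × ¬ P v
    go (yes (i , ∉)) = b i , b∈ i , ∉
    go (no none) = ⊥-elim (ℕₚ.<⇒≱ k<l (hasDim-≤ d′ d λ {v} p′ →
      span⊆ S {b = b} (λ i → decidable-stable (P? (b i)) λ ∉ → none (i , ∉)) (sp v p′)))

  meet? : ∀ M N v → Dec ((M ∩ N) v)
  meet? M N v = (v ∈? M) ×-dec (v ∈? N)

  -- The dual polar graph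

  infix 4 _~_
  _~_ : Generator → Generator → Set
  M ~ N = HasDim (M ∩ N) (1 ℕ.+ t)

  ~-sym : ∀ {M N} → M ~ N → N ~ M
  ~-sym {M} {N} = ∩-comm M N

  ~-escape : ∀ M N → M ~ N → ∃ λ n → n ∈ N × ¬ n ∈ M
  ~-escape M N d = let (v , v∈ , v∉) = escape d (meet-subspace M N) (meet? M N) (gen-dim′ N) ℕₚ.≤-refl in
    v , v∈ , λ v∈M → v∉ (v∈M , v∈)

  ~-split : ∀ M N → M ~ N → ∀ {n} → n ∈ N → ¬ n ∈ M → ∀ {u} → u ∈ N →
    ∃ λ a → ∃ λ c → (M ∩ N) a × u ≈ᵥ (a +ᵥ (c ·ᵥ n))
  ~-split M N d n∈ n∉ = hyperplane-split d (gen-dim′ N) (meet-subspace M N) proj₂ n∈ (n∉ ∘ proj₁)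

  -- N is spanned by M ∩ N and n, so the assumptions place v in the perpendicular space of N, which
  -- is N.
  ~-perp⊆ : ∀ M N → M ~ N → ∀ {n} → n ∈ N → ¬ n ∈ M → ∀ {v} →
    (∀ {u} → u ∈ M → u ∈ N → B u v ≈ 0#) → B n v ≈ 0# → v ∈ N
  ~-perp⊆ M N d n∈ n∉ {v} h nv = perp⊆ N λ u∈ → let (a , c , (a∈M , a∈N) , u≈) = ~-split M N d n∈ n∉ u∈ in
    resp (perpˡ v) (≈ᵥ-sym u≈) (add (perpˡ v) (h a∈M a∈N) (scale (perpˡ v) c nv))

  ~-perp∈ : ∀ M N → M ~ N → ∀ {n v} → n ∈ N → ¬ n ∈ M → v ∈ M → B n v ≈ 0# → v ∈ N
  ~-perp∈ M N d n∈ n∉ v∈ = ~-perp⊆ M N d n∈ n∉ λ u∈ _ → isotropic M u∈ v∈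

  -- For M ~ N these conditions make G ∩ M a hyperplane of G ∩ N.
  Gains : Generator → Generator → Generator → Set
  Gains G M N = (∀ {v} → v ∈ G → v ∈ M → v ∈ N) × ∃ λ v → v ∈ G × v ∈ N × ¬ v ∈ M

  abstract
    outside? : ∀ G M N → Dec (∃ λ v → (v ∈ G × v ∈ M) × ¬ v ∈ N)
    outside? G M N = search
      (λ {u} {v} h (p , u∉) → resp (meet-subspace G M) h p , λ v∈ → u∉ (resp (gen-subspace N) {v} {u} (≈ᵥ-sym h) v∈))
      (λ v → ((v ∈? G) ×-dec (v ∈? M)) ×-dec ¬? (v ∈? N))

  -- M is spanned by M ∩ N and v. A vector of G ∩ N is orthogonal to M ∩ N inside N and to v inside
  -- G, so it lies in M.
  gains-back : ∀ G M N → M ~ N → ∀ {v} → v ∈ G → v ∈ M → ¬ v ∈ N → Gains G N M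
  gains-back G M N d {v} v∈G v∈M v∉N =
    (λ u∈G u∈N → ~-perp⊆ N M (~-sym {M} {N} d) v∈M v∉N (λ w∈N w∈M → isotropic N w∈N u∈N) (isotropic G v∈G u∈G)) ,
    v , v∈G , v∈M , v∉N

  -- A vector n of N outside M is orthogonal to G ∩ M, hence n = g + m with g in G and m in M. All
  -- three are singular, so g and m are orthogonal; then n is orthogonal to m, which puts m into N,
  -- and g is the vector sought. This is where the quadratic form, and not just its polar form,
  -- decides.
  gains-on : ∀ G M N → M ~ N → (∀ {v} → v ∈ G → v ∈ M → v ∈ N) → ∃ λ v → v ∈ G × v ∈ N × ¬ v ∈ M
  gains-on G M N d G∩M⊆N = found (~-escape M N d)
    where
    Found : Set
    Found = ∃ λ v → v ∈ G × v ∈ N × ¬ v ∈ M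

    fromSum : ∀ {n g m} → n ∈ N → ¬ n ∈ M → g ∈ G → m ∈ M → n ≈ᵥ (g +ᵥ m) → Found
    fromSum {n} {g} {m} n∈N n∉M g∈ m∈ n≈ =
      g , g∈ , cancel (gen-subspace N) {m} {g} {n} (λ j → trans (n≈ j) (+-comm _ _)) m∈N n∈N ,
      λ g∈M → n∉M (resp (gen-subspace M) {g +ᵥ m} {n} (≈ᵥ-sym n≈) (add (gen-subspace M) {g} {m} g∈M m∈))
      where
      m⊥g : B m g ≈ 0#
      m⊥g = trans (B-sym m g) (⊥-singular (singular G g∈) (singular M m∈)
        (trans (Q-cong (≈ᵥ-sym n≈)) (singular N n∈N)))
      n⊥m : B n m ≈ 0#
      n⊥m = trans (B-sym n m) (resp (perpʳ m) {g +ᵥ m} {n} (≈ᵥ-sym n≈)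
        (add (perpʳ m) {g} {m} m⊥g (isotropic M m∈ m∈)))
      m∈N : m ∈ N
      m∈N = ~-perp∈ M N d n∈N n∉M m∈ n⊥m

    found : (∃ λ n → n ∈ N × ¬ n ∈ M) → Found
    found (n , n∈N , n∉M) =
      let (g , m , g∈ , m∈ , n≈) = meet-perp⊆ G M {n} (λ u∈G u∈M → isotropic N (G∩M⊆N u∈G u∈M) n∈N)
      in fromSum n∈N n∉M g∈ m∈ n≈

  abstract
    step : ∀ G M N → M ~ N → Gains G M N ⊎ Gains G N M
    step G M N d with outside? G M N
    ... | yes (v , (v∈G , v∈M) , v∉N) = inj₂ (gains-back G M N d v∈G v∈M v∉N)
    ... | no none = inj₁ (G∩M⊆N , gains-on G M N d G∩M⊆N)
      where
      G∩M⊆N : ∀ {v} → v ∈ G → v ∈ M → v ∈ N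
      G∩M⊆N {v} v∈G v∈M = decidable-stable (v ∈? N) λ v∉ → none (v , (v∈G , v∈M) , v∉)

  step-up : ∀ {k} G M N → M ~ N → Gains G M N → HasDim (G ∩ M) k → HasDim (G ∩ N) (suc k)
  step-up G M N d (G∩M⊆N , v , v∈G , v∈N , v∉M) h = hyperplane-dim h (meet-subspace G M)
    (λ (u∈G , u∈M) → u∈G , G∩M⊆N u∈G u∈M) (v∈G , v∈N) (v∉M ∘ proj₂) λ (u∈G , u∈N) →
      let (a , c , (a∈M , a∈N) , u≈) = ~-split M N d v∈N v∉M u∈N in
      a , c , (cancel (gen-subspace G) (λ j → trans (u≈ j) (+-comm _ _)) (scale (gen-subspace G) c v∈G) u∈G , a∈M) , u≈

  step-down : ∀ {k} G M N → M ~ N → Gains G N M → HasDim (G ∩ M) k → ∃ λ l → k ≡ suc l × HasDim (G ∩ N) l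
  step-down G M N d gains h = let (l , h′) = meet-dim G N in
    l , hasDim-unique h (step-up G N M (~-sym {M} {N} d) gains h′) , h′

  -- The meet with M has codimension 1 at N and changes by one dimension on passing to K; growing
  -- would make K equal to M.
  two-steps : ∀ M N K → M ~ N → N ~ K → ¬ Same M K → HasDim (M ∩ K) t
  two-steps M N K d d′ M≄K = go (step M N K d′)
    where
    go : Gains M N K ⊎ Gains M K N → HasDim (M ∩ K) t
    go (inj₁ gains) = ⊥-elim (M≄K (full-dim⇒Same M K (step-up M N K d′ gains d)))
    go (inj₂ gains) = let (l , eq , h) = step-down M N K d′ gains d in
      ≡.subst (HasDim (M ∩ K)) (≡.sym (ℕₚ.suc-injective eq)) h

  -- Neighbours in the dual polar graph: ⟨w⟩ + (M ∩ w^⊥) for singular w ∉ M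

  abstract
    -- Pairing with w is a nonzero functional on M, since otherwise `perp⊆` would put w into M; the
    -- space in question is its kernel.
    neighbour-dim : ∀ M {w} → ¬ w ∈ M → HasDim (λ v → v ∈ M × B v w ≈ 0#) (1 ℕ.+ t)
    neighbour-dim M {w} w∉ with bounded-basis S (λ v → (v ∈? M) ×-dec (B v w ≟ 0#))
      where
      S : Subspace (λ v → v ∈ M × B v w ≈ 0#)
      S = ∩-subspace (gen-subspace M) (perpˡ w)
    ... | k , h with Finₚ.any? (λ i → ¬? (B (proj₁ M i) w ≟ 0#))
    ...   | no none = ⊥-elim (w∉ (perp⊆ M (span⊆ (perpˡ w) λ i →
              decidable-stable (B (proj₁ M i) w ≟ 0#) λ ne → none (i , ne))))
    ...   | yes (i , ne) = ≡.subst (HasDim _) (ℕₚ.suc-injective (hasDim-unique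
              (hyperplane-dim h (∩-subspace (gen-subspace M) (perpˡ w)) proj₁ (basis∈span (proj₁ M) i) (ne ∘ proj₂) split)
              (gen-dim′ M))) h
      where
      m : V n
      m = proj₁ M i
      split : ∀ {u} → u ∈ M → ∃ λ a → ∃ λ c → (a ∈ M × B a w ≈ 0#) × u ≈ᵥ (a +ᵥ (c ·ᵥ m))
      split {u} u∈ = let (y , ym) = inverse ne ; c = B u w * y in
        (u +ᵥ ((- c) ·ᵥ m)) , c ,
        (add (gen-subspace M) u∈ (scale (gen-subspace M) (- c) (basis∈span (proj₁ M) i)) ,
         trans (B-addˡ _ _ w) (trans (+-congˡ (trans (B-scaleˡ _ m w)
           (trans (sym (-‿distribˡ-* _ _)) (-‿cong (trans (*-assoc _ _ _) (trans (*-congˡ ym) (*-identityʳ _))))))) (-‿inverseʳ _))) ,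
        λ j → sym (trans (+-congʳ (+-congˡ (sym (-‿distribˡ-* c (m j))))) (x-y+y≈x _ _))
  
  reindex : ∀ {k l} → l ≡ k → (b : Fin k → V n) → TSSubspace Q k b →
    ∃ λ (a : Fin l → V n) → TSSubspace Q l a × (∀ {v} → InSpan b v → InSpan a v) × (∀ {v} → InSpan a v → InSpan b v)
  reindex ≡.refl b ts = b , ts , (λ x → x) , (λ x → x)

  record Neighbour (M : Generator) (w : V n) : Set where
    field
      neighbour : Generator
      w∈neighbour : w ∈ neighbour
      perp∈neighbour : ∀ {v} → v ∈ M → B v w ≈ 0# → v ∈ neighbour
      neighbour-adjacent : M ~ neighbour
      neighbour-unique : ∀ N → M ~ N → w ∈ N → Same neighbour N

  makeNeighbour : ∀ M w → Q w ≈ 0# → ¬ w ∈ M → Neighbour M w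
  makeNeighbour M w Qw w∉ with neighbour-dim M w∉
  ... | d@(b , b∈ , ib , b-spans) with reindex r≡2+t (w ∷ b) (extend-indep {b = b} ib (λ w∈ → w∉ (proj₁ (span⊆ S {b = b} b∈ w∈))) , ts)
    where
    S : Subspace (λ v → v ∈ M × B v w ≈ 0#)
    S = ∩-subspace (gen-subspace M) (perpˡ w)

    ts : TotallySingular Q (w ∷ b)
    ts v (c , v≈) = let (u∈ , uw) = lincomb∈ S (c ∘ suc) b b∈ in
      trans (Q-cong v≈) (singular-+ (singular-· (c zero) Qw) (singular M u∈)
        (trans (B-scaleˡ _ w _) (trans (*-congˡ (trans (B-sym w _) uw)) (zeroʳ _))))
  ...   | a , ts , to , from = record
    { neighbour = N
    ; w∈neighbour = w∈N
    ; perp∈neighbour = perp∈N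
    ; neighbour-adjacent = hasDim-resp (λ (v∈ , vw) → v∈ , perp∈N v∈ vw)
        (λ (v∈M , v∈N) → v∈M , isotropic N v∈N w∈N) d
    ; neighbour-unique = λ K M~K w∈K → ⊆⇒Same N K λ v∈ → span⊆ (gen-subspace K) {b = w ∷ b}
        (λ { zero → w∈K
           ; (suc i) → ~-perp∈ M K M~K w∈K w∉ (proj₁ (b∈ i)) (trans (B-sym w (b i)) (proj₂ (b∈ i))) })
        (from v∈)
    }
    where
    N : Generator
    N = a , ts
    w∈N : w ∈ N
    w∈N = to (span-zero (w ∷ b))
    perp∈N : ∀ {v} → v ∈ M → B v w ≈ 0# → v ∈ N
    perp∈N {v} v∈ vw = to (span-suc (w ∷ b) (b-spans v (v∈ , vw)))

  open Neighbour

  -- Enumerations of neighbours and of common neighbours.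

  record Enumeration (P : Generator → Set) (k : ℕ) : Set where
    field
      enum : Fin k → Generator
      enum-hits : ∀ p → P (enum p)
      enum-injective : ∀ p p′ → Same (enum p) (enum p′) → p ≡ p′
      enum-onto : ∀ N → P N → ∃ λ p → Same (enum p) N

  -- A neighbour of M is determined by any of its vectors outside M. It lies in M + ⟨w⟩, so two
  -- vectors of the list can give the same neighbour only if they are proportional modulo M, which
  -- `distinct` excludes.
  enumerate : ∀ M {k} (w : Fin k → V n) {P : Generator → Set} → (∀ p → Q (w p) ≈ 0#) → (w∉ : ∀ p → ¬ w p ∈ M) →
    (∀ p p′ m a → m ∈ M → w p′ ≈ᵥ (m +ᵥ (a ·ᵥ w p)) → p ≡ p′) →
    (∀ p (N : Neighbour M (w p)) → P (neighbour N)) → (∀ N → P N → M ~ N × ∃ λ p → w p ∈ N) → Enumeration P k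
  enumerate M w {P} Qw w∉ distinct hits onto = record
    { enum = λ p → neighbour (N p)
    ; enum-hits = λ p → hits p (N p)
    ; enum-injective = λ p p′ same →
        let (m , a , (m∈ , _) , w′≈) = ~-split M (neighbour (N p)) (neighbour-adjacent (N p)) (w∈neighbour (N p)) (w∉ p)
                                          (proj₂ (same (w p′)) (w∈neighbour (N p′)))
        in distinct p p′ m a m∈ w′≈
    ; enum-onto = λ K PK → let (M~K , p , w∈) = onto K PK in p , neighbour-unique (N p) K M~K w∈
    }
    where
    N : ∀ p → Neighbour M (w p)
    N p = makeNeighbour M (w p) (Qw p) (w∉ p)

  -- A point p prescribes, up to a scalar, a nonzero functional on M by its values on the basis `b`.
  -- It is realised as pairing with a singular vector `w p`, and its kernel is the meet of M with
  -- the neighbour through `w p`.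
  module Neighbours (M : Generator) where
    b : Fin r → V n
    b = proj₁ M

    lift : ∀ p → ∃ λ w → Q w ≈ 0# × (∀ i → B (b i) w ≈ point r p i)
    lift p = interpolate-singular b (proj₁ (proj₂ M)) (proj₂ (proj₂ M)) (point r p)
      (proj₁ (point-nonzero r p)) (proj₂ (point-nonzero r p))

    w : Fin (#points r) → V n
    w p = proj₁ (lift p)

    Bw : ∀ p i → B (b i) (w p) ≈ point r p i
    Bw p = proj₂ (proj₂ (lift p))

    w∉ : ∀ p → ¬ w p ∈ M
    w∉ p w∈ = let (i , ne) = point-nonzero r p in
      ne (trans (sym (Bw p i)) (isotropic M (basis∈span b i) w∈))

    distinct : ∀ p p′ m a → m ∈ M → w p′ ≈ᵥ (m +ᵥ (a ·ᵥ w p)) → p ≡ p′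
    distinct p p′ m a m∈ w′≈ = point-injective r p p′ a λ i → begin
      point r p′ i                             ≈⟨ Bw p′ i ⟨
      B (b i) (w p′)                           ≈⟨ B-cong (λ _ → refl) w′≈ ⟩
      B (b i) (m +ᵥ (a ·ᵥ w p))                ≈⟨ B-addʳ (b i) m _ ⟩
      B (b i) m + B (b i) (a ·ᵥ w p)           ≈⟨ +-cong (isotropic M (basis∈span b i) m∈) (B-scaleʳ a (b i) (w p)) ⟩
      0# + a * B (b i) (w p)                   ≈⟨ +-identityˡ _ ⟩
      a * B (b i) (w p)                        ≈⟨ *-congˡ (Bw p i) ⟩
      a * point r p i ∎
      where open import Relation.Binary.Reasoning.Setoid setoid

    onto : ∀ N → M ~ N → M ~ N × ∃ λ p → w p ∈ N
    onto N d = d , found (~-escape M N d)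
      where
      found : (∃ λ v → v ∈ N × ¬ v ∈ M) → ∃ λ p → w p ∈ N
      found (v , v∈ , v∉) = p , unscale (gen-subspace N) a≉0
          (resp (gen-subspace N) {v +ᵥ m} {a ·ᵥ w p} (≈ᵥ-sym aw≈) (add (gen-subspace N) {v} {m} v∈ m∈N))
        where
        nz : ¬ ((λ i → B (b i) v) ≈ᵥ 0ᵥ)
        nz h = v∉ (perp⊆ M λ u∈ → span⊆ (perpˡ v) {b = b} h u∈)
        normal : ∃ λ p → ∃ λ a → ¬ (a ≈ 0#) × (λ i → B (b i) v) ≈ᵥ (a ·ᵥ point r p)
        normal = normalise r (λ i → B (b i) v) nz
        p : Fin (#points r)
        p = proj₁ normal
        a : F
        a = proj₁ (proj₂ normal)
        a≉0 : ¬ (a ≈ 0#)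
        a≉0 = proj₁ (proj₂ (proj₂ normal))
        m : V n
        m = (a ·ᵥ w p) +ᵥ ((- 1#) ·ᵥ v)
        aw≈ : (a ·ᵥ w p) ≈ᵥ (v +ᵥ m)
        aw≈ j = sym (trans (+-comm _ _) (trans (+-congʳ (+-congˡ (-1*x≈-x _))) (x-y+y≈x _ _)))
        m∈ : m ∈ M
        m∈ = perp⊆ M λ u∈ → span⊆ (perpˡ m) {b = b} (λ i →
          trans (B-addʳ (b i) _ _) (trans (+-cong (trans (B-scaleʳ a (b i) (w p)) (trans (*-congˡ (Bw p i)) (sym (proj₂ (proj₂ (proj₂ normal)) i))))
            (trans (B-scaleʳ _ (b i) v) (-1*x≈-x _))) (-‿inverseʳ _))) u∈
        -- v, m and their sum a · w p are all singular. Hence v is orthogonal to m, m lies in N, and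
        -- so does `w p`: only one neighbour belongs to each functional.
        v⊥m : B v m ≈ 0#
        v⊥m = ⊥-singular (singular N v∈) (singular M m∈)
          (trans (Q-cong (≈ᵥ-sym aw≈)) (singular-· a (proj₁ (proj₂ (lift p)))))
        m∈N : m ∈ N
        m∈N = ~-perp∈ M N d v∈ v∉ m∈ v⊥m

    neighbours : Enumeration (M ~_) (#points r)
    neighbours = enumerate M w (λ p → proj₁ (proj₂ (lift p))) w∉ distinct (λ p N → neighbour-adjacent N) onto

  -- u₁ and u₂ complete a basis of M ∩ K to one of K. Each common neighbour meets K in one dimension
  -- more than M does, and thereby picks a point of the projective line on ⟨u₁, u₂⟩.
  module CommonNeighbours (M K : Generator) (d : HasDim (M ∩ K) t) where
    a : Fin t → V n
    a = proj₁ d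

    a∈ : ∀ i → (M ∩ K) (a i)
    a∈ = proj₁ (proj₂ d)

    find₁ : ∃ λ u → u ∈ K × ¬ (M ∩ K) u
    find₁ = escape d (meet-subspace M K) (meet? M K) (gen-dim′ K) (s≤s (ℕₚ.n≤1+n t))

    u₁ : V n
    u₁ = proj₁ find₁

    indep₁ : LinIndep (u₁ ∷ a)
    indep₁ = extend-indep {b = a} (proj₁ (proj₂ (proj₂ d))) λ u∈ → proj₂ (proj₂ find₁) (span⊆ (meet-subspace M K) {b = a} a∈ u∈)

    find₂ : ∃ λ u → u ∈ K × ¬ InSpan (u₁ ∷ a) u
    find₂ = escape (u₁ ∷ a , basis∈span (u₁ ∷ a) , indep₁ , λ v v∈ → v∈) (span-subspace (u₁ ∷ a)) (inSpan? (u₁ ∷ a))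
      (gen-dim′ K) ℕₚ.≤-refl

    u₂ : V n
    u₂ = proj₁ find₂

    c : Fin (2 ℕ.+ t) → V n
    c = u₂ ∷ u₁ ∷ a

    indep₂ : LinIndep c
    indep₂ = extend-indep {b = u₁ ∷ a} indep₁ (proj₂ (proj₂ find₂))

    c∈ : ∀ i → c i ∈ K
    c∈ zero = proj₁ (proj₂ find₂)
    c∈ (suc zero) = proj₁ (proj₂ find₁)
    c∈ (suc (suc i)) = proj₂ (a∈ i)

    comb : V 2 → V n
    comb x = (x zero ·ᵥ u₂) +ᵥ (x (suc zero) ·ᵥ u₁)

    comb∈ : ∀ x → comb x ∈ K
    comb∈ x = add (gen-subspace K) (scale (gen-subspace K) _ (c∈ zero)) (scale (gen-subspace K) _ (c∈ (suc zero)))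

    comb-indep : ∀ x → comb x ∈ M → x ≈ᵥ 0ᵥ
    comb-indep x ∈M = λ { zero → eq zero ; (suc zero) → eq (suc zero) }
      where
      y : InSpan a (comb x)
      y = proj₂ (proj₂ (proj₂ d)) _ (∈M , comb∈ x)
      -- The vector lies in M ∩ K and so has a second expansion in `a` alone; uniqueness of
      -- coordinates in the basis `c` of K makes both entries of x vanish.
      eq : (x zero ∷ x (suc zero) ∷ 0ᵥ) ≈ᵥ (0# ∷ 0# ∷ proj₁ y)
      eq = lincomb-injective c indep₂ _ _ λ j → trans
        (trans (sym (+-assoc _ _ _)) (trans (+-congˡ (sumF-0 λ i → zeroˡ (a i j))) (+-identityʳ _)))
        (trans (proj₂ y j) (sym (trans (+-cong (zeroˡ _) (trans (+-congʳ (zeroˡ _)) (+-identityˡ _))) (+-identityˡ _))))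

    comb-spans : ∀ {v} → v ∈ K → ∃ λ m → ∃ λ x → (M ∩ K) m × v ≈ᵥ (m +ᵥ comb x)
    comb-spans {v} v∈ = lincomb (λ i → proj₁ z (suc (suc i))) a , (λ i → proj₁ z (i ↑ˡ t)) ,
      lincomb∈ (meet-subspace M K) (λ i → proj₁ z (suc (suc i))) a a∈ ,
      λ j → trans (proj₂ z j) (trans (sym (+-assoc _ _ _)) (+-comm _ _))
      where
      z : InSpan c v
      z = full-indep-spans {P = _∈ K} c (proj₁ (gen-dim′ K)) indep₂ c∈ (λ {u} → proj₂ (proj₂ (proj₂ (gen-dim′ K))) u) v∈

    w : Fin (#points 2) → V n
    w p = comb (point 2 p)

    w∉ : ∀ p → ¬ w p ∈ M
    w∉ p w∈ = let (i , ne) = point-nonzero 2 p in ne (comb-indep (point 2 p) w∈ i)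

    distinct : ∀ p p′ m x → m ∈ M → w p′ ≈ᵥ (m +ᵥ (x ·ᵥ w p)) → p ≡ p′
    distinct p p′ m x m∈ w′≈ = point-injective 2 p p′ x λ i → x∙y⁻¹≈ε⇒x≈y _ _
        (trans (+-congˡ (-‿distribˡ-* x _)) (comb-indep y (resp (gen-subspace M) {m} {comb y} (≈ᵥ-sym y≈) m∈) i))
      where
      open import Relation.Binary.Reasoning.Setoid setoid
      y : V 2
      y = point 2 p′ +ᵥ ((- x) ·ᵥ point 2 p)
      y≈ : comb y ≈ᵥ m
      y≈ j = begin
        comb y j
          ≈⟨ +-cong (distribʳ _ _ _) (distribʳ _ _ _) ⟩
        (point 2 p′ zero * u₂ j + (- x * point 2 p zero) * u₂ j) + (point 2 p′ (suc zero) * u₁ j + (- x * point 2 p (suc zero)) * u₁ j)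
          ≈⟨ interchange _ _ _ _ ⟩
        w p′ j + ((- x * point 2 p zero) * u₂ j + (- x * point 2 p (suc zero)) * u₁ j)
          ≈⟨ +-congˡ (trans (+-cong (*-assoc _ _ _) (*-assoc _ _ _)) (sym (distribˡ _ _ _))) ⟩
        w p′ j + - x * w p j
          ≈⟨ +-cong (w′≈ j) (sym (-‿distribˡ-* x _)) ⟩
        (m j + x * w p j) - x * w p j
          ≈⟨ trans (+-congʳ (+-comm _ _)) (x+y-x≈y _ _) ⟩
        m j ∎

    -- As `w p` lies in K, it is orthogonal to M ∩ K; the neighbour therefore contains M ∩ K
    -- together with `w p`.
    hits : ∀ p (N : Neighbour M (w p)) → M ~ neighbour N × K ~ neighbour N
    hits p N = neighbour-adjacent N , step-up K M (neighbour N) (neighbour-adjacent N)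
      ((λ v∈K v∈M → perp∈neighbour N v∈M (isotropic K v∈K (comb∈ (point 2 p)))) ,
       w p , comb∈ (point 2 p) , w∈neighbour N , w∉ p) (∩-comm M K d)

    onto : ∀ N → M ~ N × K ~ N → M ~ N × ∃ λ p → w p ∈ N
    onto N (M~N , K~N) = M~N , found (escape d (meet-subspace M K) (meet? M K) K~N ℕₚ.≤-refl)
      where
      found : (∃ λ v → (K ∩ N) v × ¬ (M ∩ K) v) → ∃ λ p → w p ∈ N
      found (v , (v∈K , v∈N) , v∉) = p , remainder (gen-subspace N) {y} {w p} {m} {v}
          (λ j → trans (v≈ j) (+-congˡ (trans (+-cong (trans (*-congʳ (x≈ zero)) (*-assoc _ _ _))
            (trans (*-congʳ (x≈ (suc zero))) (*-assoc _ _ _))) (sym (distribˡ _ _ _)))))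
          y≉0 v∈N m∈N
        where
        v∉M : ¬ v ∈ M
        v∉M v∈M = v∉ (v∈M , v∈K)
        spans = comb-spans v∈K
        m : V n
        m = proj₁ spans
        x : V 2
        x = proj₁ (proj₂ spans)
        m∈ : (M ∩ K) m
        m∈ = proj₁ (proj₂ (proj₂ spans))
        v≈ : v ≈ᵥ (m +ᵥ comb x)
        v≈ = proj₂ (proj₂ (proj₂ spans))
        nz : ¬ (x ≈ᵥ 0ᵥ)
        nz x≈0 = v∉M (resp (gen-subspace M) {m} {v} (λ j → sym (trans (v≈ j) (trans (+-congˡ
          (trans (+-cong (trans (*-congʳ (x≈0 zero)) (zeroˡ _)) (trans (*-congʳ (x≈0 (suc zero))) (zeroˡ _))) (+-identityˡ 0#)))
          (+-identityʳ _)))) (proj₁ m∈))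
        normal : ∃ λ p → ∃ λ y → ¬ (y ≈ 0#) × x ≈ᵥ (y ·ᵥ point 2 p)
        normal = normalise 2 x nz
        p : Fin (#points 2)
        p = proj₁ normal
        y : F
        y = proj₁ (proj₂ normal)
        y≉0 : ¬ (y ≈ 0#)
        y≉0 = proj₁ (proj₂ (proj₂ normal))
        x≈ : x ≈ᵥ (y ·ᵥ point 2 p)
        x≈ = proj₂ (proj₂ (proj₂ normal))
        -- v and m both lie in K, so they are orthogonal, which puts m into N; subtracting it from v
        -- leaves a nonzero multiple of `w p`.
        m∈N : m ∈ N
        m∈N = ~-perp∈ M N M~N v∈N v∉M (proj₁ m∈) (isotropic K v∈K (proj₂ m∈))

    commonNeighbours : Enumeration (λ N → M ~ N × K ~ N) (#points 2)
    commonNeighbours = enumerate M w (λ p → singular K (comb∈ (point 2 p))) w∉ distinct hits onto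

  -- If M were the sum of M ∩ K and M ∩ L, then K ∩ L, being orthogonal to both, would lie in M and so coincide with them.
  common-triangle : ∀ M K L → HasDim (M ∩ K) t → HasDim (M ∩ L) t → HasDim (K ∩ L) t → ∃ λ N → M ~ N × K ~ N × L ~ N
  common-triangle M K L dK@(a , a∈ , _ , a-spans) dL@(b , b∈ , _ , b-spans) dKL = go (Finₚ.any? λ i → ¬? (inSpan? c (proj₁ M i)))
    where
    c : Fin (t ℕ.+ t) → V n
    c = a ++ b

    c-all : ∀ {P : V n → Set} → (∀ i → P (a i)) → (∀ i → P (b i)) → ∀ k → P (c k)
    c-all pa pb k with splitAt t k
    ... | inj₁ i = pa i
    ... | inj₂ i = pb i

    go : Dec (∃ λ i → ¬ InSpan c (proj₁ M i)) → ∃ λ N → M ~ N × K ~ N × L ~ N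
    go (no none) = ⊥-elim (ℕₚ.<⇒≱ (s≤s (ℕₚ.n≤1+n t)) (hasDim-≤ (gen-dim′ M) dL λ v∈ → v∈ ,
        span⊆ (gen-subspace L) {b = c} (c-all {P = _∈ L} (λ i → M∩K⊆L (a∈ i)) (λ i → proj₂ (b∈ i))) (M⊆c v∈)))
      where
      M⊆c : ∀ {v} → v ∈ M → InSpan c v
      M⊆c = span⊆ (span-subspace c) {b = proj₁ M} λ i → decidable-stable (inSpan? c (proj₁ M i)) λ ∉ → none (i , ∉)
      K∩L⊆M : ∀ {v} → (K ∩ L) v → v ∈ M
      K∩L⊆M {v} (v∈K , v∈L) = perp⊆ M λ u∈ → span⊆ (perpˡ v) {b = c}
        (c-all {P = λ u → B u v ≈ 0#} (λ i → isotropic K (proj₂ (a∈ i)) v∈K) (λ i → isotropic L (proj₂ (b∈ i)) v∈L)) (M⊆c u∈)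
      M∩K⊆L : ∀ {v} → (M ∩ K) v → v ∈ L
      M∩K⊆L m = proj₂ (same-dim (meet-subspace K L) dKL dK (λ (v∈K , v∈L) → K∩L⊆M (v∈K , v∈L) , v∈K) m)
    go (yes (i , v∉)) = neighbour N , M~N , contains K (λ u∈K u∈M → span⊆ (perpˡ w) {b = a} a⊥w (a-spans _ (u∈M , u∈K))) (∩-comm M K dK) ,
        contains L (λ u∈L u∈M → span⊆ (perpˡ w) {b = b} b⊥w (b-spans _ (u∈M , u∈L))) (∩-comm M L dL)
      where
      v : V n
      v = proj₁ M i
      v∈ : v ∈ M
      v∈ = basis∈span (proj₁ M) i
      -- Here v in M is outside the sum of M ∩ K and M ∩ L. A vector orthogonal to that sum but not
      -- to v is made singular by adding a multiple of v; this leaves its pairing with M unchanged.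
      -- The neighbour of M through it contains M ∩ K and M ∩ L.
      sep : ∃ λ w → (∀ k → B (c k) w ≈ 0#) × B v w ≈ 1#
      sep = separate c v∉
      w₀ : V n
      w₀ = proj₁ sep
      x : F
      x = - Q w₀
      w : V n
      w = w₀ +ᵥ (x ·ᵥ v)
      Qw : Q w ≈ 0#
      Qw = trans (Q-+ _ _) (trans (+-cong (trans (+-congˡ (singular-· x (singular M v∈))) (+-identityʳ _))
        (trans (B-scaleʳ x w₀ v) (trans (*-congˡ (trans (B-sym w₀ v) (proj₂ (proj₂ sep)))) (*-identityʳ x)))) (-‿inverseʳ _))
      B-w : ∀ {u} → u ∈ M → B u w ≈ B u w₀
      B-w {u} u∈ = trans (B-addʳ u _ _) (trans (+-congˡ (trans (B-scaleʳ x u v) (trans (*-congˡ (isotropic M u∈ v∈)) (zeroʳ x)))) (+-identityʳ _))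
      a⊥w : ∀ k → B (a k) w ≈ 0#
      a⊥w k = trans (B-w (proj₁ (a∈ k))) (≡.subst (λ u → B u w₀ ≈ 0#) (lookup-++ˡ a b k) (proj₁ (proj₂ sep) (k ↑ˡ t)))
      b⊥w : ∀ k → B (b k) w ≈ 0#
      b⊥w k = trans (B-w (proj₁ (b∈ k))) (≡.subst (λ u → B u w₀ ≈ 0#) (lookup-++ʳ a b k) (proj₁ (proj₂ sep) (t ↑ʳ k)))
      w∉ : ¬ w ∈ M
      w∉ w∈ = 1≉0 (trans (sym (proj₂ (proj₂ sep))) (trans (sym (B-w v∈)) (isotropic M v∈ w∈)))
      N : Neighbour M w
      N = makeNeighbour M w Qw w∉
      M~N : M ~ neighbour N
      M~N = neighbour-adjacent N
      contains : ∀ G → (∀ {u} → u ∈ G → u ∈ M → B u w ≈ 0#) → HasDim (G ∩ M) t → G ~ neighbour N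
      contains G G⊥w dG = up (step G M (neighbour N) M~N)
        where
        up : Gains G M (neighbour N) ⊎ Gains G (neighbour N) M → G ~ neighbour N
        up (inj₁ gains) = step-up G M (neighbour N) M~N gains dG
        -- The meet with G cannot shrink: G ∩ M is orthogonal to w and hence inside the neighbour.
        up (inj₂ (_ , u , u∈G , u∈M , u∉)) = ⊥-elim (u∉ (perp∈neighbour N u∈M (G⊥w u∈G u∈M)))

  -- Parity of intersection dimensions.

  step-parity : ∀ {k} G M N → M ~ N → HasDim (G ∩ M) k → HasDim (G ∩ N) (suc k) ⊎ (∃ λ l → k ≡ suc l × HasDim (G ∩ N) l)
  step-parity {k} G M N d h = go (step G M N d)
    where
    go : Gains G M N ⊎ Gains G N M → HasDim (G ∩ N) (suc k) ⊎ (∃ λ l → k ≡ suc l × HasDim (G ∩ N) l)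
    go (inj₁ gains) = inj₁ (step-up G M N d gains h)
    go (inj₂ gains) = inj₂ (step-down G M N d gains h)

  OddMeet : Generator → Generator → Set
  OddMeet G M = ∃ λ k → HasDim (G ∩ M) k × k % 2 ≡ 1

  -- Two changes by one alter the dimension by -2, 0 or 2, so neighbours of a neighbour return to
  -- the family.
  odd-meet : ∀ G M N K → M ~ N → N ~ K → OddMeet G M → OddMeet G K
  odd-meet G M N K d d′ (k , h , odd) = first (step-parity G M N d h)
    where
    first : HasDim (G ∩ N) (suc k) ⊎ (∃ λ l → k ≡ suc l × HasDim (G ∩ N) l) → OddMeet G K
    first (inj₁ h₁) = second (step-parity G N K d′ h₁)
      where
      second : HasDim (G ∩ K) (2 ℕ.+ k) ⊎ (∃ λ l → suc k ≡ suc l × HasDim (G ∩ K) l) → OddMeet G K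
      second (inj₁ h₂) = 2 ℕ.+ k , h₂ , odd
      second (inj₂ (l , eq , h₂)) = l , h₂ , ≡.trans (≡.cong (_% 2) (≡.sym (ℕₚ.suc-injective eq))) odd
    first (inj₂ (l , k≡ , h₁)) = second (step-parity G N K d′ h₁)
      where
      second : HasDim (G ∩ K) (suc l) ⊎ (∃ λ l′ → l ≡ suc l′ × HasDim (G ∩ K) l′) → OddMeet G K
      second (inj₁ h₂) = suc l , h₂ , ≡.trans (≡.cong (_% 2) (≡.sym k≡)) odd
      second (inj₂ (l′ , l≡ , h₂)) = l′ , h₂ , ≡.trans (≡.cong (_% 2) (≡.sym (≡.trans k≡ (≡.cong suc l≡)))) odd

allPairs-lookup : ∀ {A : Set} {S : A → A → Set} {xs : List A} → (∀ {x y} → S x y → S y x) → AllPairs S xs →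
  ∀ {i j} → i ≢ j → S (lookup xs i) (lookup xs j)
allPairs-lookup S-sym (_ AllPairs.∷ _) {zero} {zero} i≢j = ⊥-elim (i≢j ≡.refl)
allPairs-lookup S-sym (px AllPairs.∷ _) {zero} {suc j} i≢j = All.lookup px (∈-lookup j)
allPairs-lookup S-sym (px AllPairs.∷ _) {suc i} {zero} i≢j = S-sym (All.lookup px (∈-lookup i))
allPairs-lookup S-sym (_ AllPairs.∷ ps) {suc i} {suc j} i≢j = allPairs-lookup S-sym ps (i≢j ∘ ≡.cong suc)

-- The graph Γ: from lists of bases to the incidence matrix.

module HalfSpin
  (R : CommutativeRing 0ℓ 0ℓ) (isField : Geometry.IsField R) (q : ℕ) (order : Geometry.HasOrder R q)
  (Q : Geometry.V R 10 → CommutativeRing.Carrier R)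
  (isQuadratic : Geometry.IsQuadraticForm R Q) (nondegenerate : Geometry.Nondegenerate R Q)
  (M0 : Geometry.Gen R) (ts0 : Geometry.TSSubspace R Q 5 M0) where

  open import Data.Nat using (_+_; _*_)
  open Counting using (𝟙; 𝟙-×; Inj; count-enum; Incidence; separating)
  open import Algebra.Properties.Semiring.Sum ℕₚ.+-*-semiring using (sum; sum-cong-≗)
  open Geometry R
  open LinearAlgebra R isField q order using (#points; 2≤q; hasDim-resp)
  open DualPolar R isField q order 10 5 3 ℕₚ.≤-refl ≡.refl Q isQuadratic nondegenerate

  G0 : Generator
  G0 = M0 , ts0

  Distinct : ∀ {k} → (Fin k → Generator) → Set
  Distinct X = ∀ {i j} → i ≢ j → ¬ Same (X i) (X j)

  distinct⇒≡ : ∀ {k} (X : Fin k → Generator) → Distinct X → ∀ {i j} → Same (X i) (X j) → i ≡ j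
  distinct⇒≡ X dX {i} {j} same = decidable-stable (i Finₚ.≟ j) λ i≢j → dX i≢j same

  -- An `Enumeration` supplies its own representatives; `position` carries them to those in the
  -- fixed list X, and distinctness on both sides makes this a bijection.
  enumeration-count : ∀ {k m} {P : Generator → Set} (X : Fin m → Generator) → Distinct X →
    (∀ {M N} → Same M N → P M → P N) → (∀ N → P N → ∃ λ j → Same N (X j)) →
    Enumeration P k → (P? : ∀ j → Dec (P (X j))) → sum (λ j → 𝟙 (P? j)) ≡ k
  enumeration-count {k} {m} {P} X dX P-resp position E P? = count-enum P? f
      (λ {s} {t} eq → enum-injective s t (Same-trans {enum s} {X (f s)} {enum t} (same s)
        (≡.subst (λ j → Same (X j) (enum t)) (≡.sym eq) (Same-sym {enum t} {X (f t)} (same t)))))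
      (λ s → P-resp {enum s} {X (f s)} (same s) (enum-hits s))
      (λ j Pj → let (s , h) = enum-onto (X j) Pj in
        s , distinct⇒≡ X dX (Same-trans {X (f s)} {enum s} {X j} (Same-sym {enum s} {X (f s)} (same s)) h))
    where
    open Enumeration E
    f : Fin k → Fin m
    f s = proj₁ (position (enum s) (enum-hits s))
    same : ∀ s → Same (enum s) (X (f s))
    same s = proj₂ (position (enum s) (enum-hits s))

  enum-map : ∀ {k} {P P′ : Generator → Set} → (∀ N → P N → P′ N) → (∀ N → P′ N → P N) → Enumeration P k → Enumeration P′ k
  enum-map to from E = record
    { enum = enum
    ; enum-hits = λ p → to (enum p) (enum-hits p)
    ; enum-injective = enum-injective
    ; enum-onto = λ N → enum-onto N ∘ from N
    }
    where open Enumeration E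

  member : ∀ {xs} → All (InFamily Q M0) xs → Fin (length xs) → Generator
  member {xs} fam i = lookup xs i , proj₁ (All.lookup fam (∈-lookup i))

  member-odd : ∀ {xs} (fam : All (InFamily Q M0) xs) i → OddMeet G0 (member fam i)
  member-odd fam i = let (k , d , odd) = proj₂ (All.lookup fam (∈-lookup i)) in
    k , ∩-comm (member fam i) G0 d , odd

  G0-odd : OddMeet G0 G0
  G0-odd = 5 , Same⇒full-dim G0 G0 (λ v → (λ x → x) , (λ x → x)) , ≡.refl

  Same-refl : ∀ M → Same M M
  Same-refl M v = (λ x → x) , (λ x → x)

  sameDecSetoid : DecSetoid 0ℓ 0ℓ
  sameDecSetoid = record
    { Carrier = Generator
    ; _≈_ = Same
    ; isDecEquivalence = record
      { isEquivalence = record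
        { refl = λ {M} → Same-refl M
        ; sym = λ {M} {N} → Same-sym {M} {N}
        ; trans = λ {M} {N} {K} → Same-trans {M} {N} {K}
        }
      ; _≟_ = Same?
      }
    }

  #points-5 : #points 5 ≡ 1 + q * ((1 + q) * (1 + q * q))
  #points-5 = lem q
    where
    lem : ∀ q → q * (q * (q * (q * 1))) + (q * (q * (q * 1)) + (q * (q * 1) + (q * 1 + 1))) ≡ 1 + q * ((1 + q) * (1 + q * q))
    lem = solve-∀

  #points-2 : #points 2 ≡ suc q
  #points-2 = lem q
    where
    lem : ∀ q → q * 1 + 1 ≡ suc q
    lem = solve-∀

  module Vertices (L : List Gen) (isL : IsVertexList Q M0 L) where
    m : ℕ
    m = length L

    X : Fin m → Generator
    X = member (proj₁ isL)

    X-odd : ∀ i → OddMeet G0 (X i)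
    X-odd = member-odd (proj₁ isL)

    X-distinct : Distinct X
    X-distinct {i} {j} = allPairs-lookup {S = λ b b′ → ¬ SameSpace b b′} (λ h s → h λ v → swap (s v)) (proj₁ (proj₂ isL)) {i} {j}

    X-position : ∀ M → OddMeet G0 M → ∃ λ i → Same M (X i)
    X-position M (k , d , odd) = Any.index found , Anyₚ.lookup-index found
      where
      found : Any (SameSpace (proj₁ M)) L
      found = proj₂ (proj₂ isL) (proj₁ M) (proj₂ M , k , ∩-comm G0 M d , odd)

    -- The other family enters only through the neighbours of listed vertices, repeated once for
    -- every vertex next to them, whence the deduplication below.
    allNeighbours : List Generator
    allNeighbours = concat (tabulate λ i → tabulate (Enumeration.enum (Neighbours.neighbours (X i))))

    neighbourList : List Generator
    neighbourList = deduplicate Same? allNeighbours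

    n : ℕ
    n = length neighbourList

    Y : Fin n → Generator
    Y = lookup neighbourList

    Y-distinct : Distinct Y
    Y-distinct {i} {j} = allPairs-lookup {S = λ M N → ¬ Same M N} (λ {M} {N} h s → h (Same-sym {N} {M} s))
      (deduplicate-! sameDecSetoid allNeighbours) {i} {j}

    Y-position : ∀ i N → X i ~ N → ∃ λ j → Same N (Y j)
    Y-position i N d = Any.index found , Same-trans {N} {enum p} {Y (Any.index found)} (Same-sym {enum p} {N} (proj₂ onto)) (Anyₚ.lookup-index found)
      where
      open Enumeration (Neighbours.neighbours (X i))
      onto : ∃ λ p → Same (enum p) N
      onto = enum-onto N d
      p = proj₁ onto
      found : Any (Same (enum p)) neighbourList
      found = Anyₚ.deduplicate⁺ Same? {P = Same (enum p)} (λ {M} {K} s t → Same-trans {enum p} {M} {K} t (Same-sym {K} {M} s))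
        (Anyₚ.concat⁺ (Anyₚ.tabulate⁺ i (Anyₚ.tabulate⁺ p (Same-refl (enum p)))))

    adj : Fin m → Fin n → Set
    adj i j = X i ~ Y j

    odd-via : ∀ i N K → X i ~ N → N ~ K → OddMeet G0 K
    odd-via i N K d d′ = odd-meet G0 (X i) N K d d′ (X-odd i)

    adj? : ∀ i j → Dec (adj i j)
    adj? i j = meet-dim? 4 (X i) (Y j)

    common-dim : ∀ {i i′ j} → i ≢ i′ → adj i j → adj i′ j → HasDim (X i ∩ X i′) 3
    common-dim {i} {i′} {j} i≢ d d′ = two-steps (X i) (Y j) (X i′) d (∩-comm (X i′) (Y j) d′) (X-distinct i≢)

    common-dim′ : ∀ {i j j′} → j ≢ j′ → adj i j → adj i j′ → HasDim (Y j ∩ Y j′) 3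
    common-dim′ {i} {j} {j′} j≢ d d′ = two-steps (Y j) (X i) (Y j′) (∩-comm (X i) (Y j) d) d′ (Y-distinct j≢)

    respˡ : ∀ K {M N} → Same M N → M ~ K → N ~ K
    respˡ K {M} {N} s = meet-dim-resp M N K K s (Same-refl K)

    respʳ : ∀ K {M N} → Same M N → K ~ M → K ~ N
    respʳ K {M} {N} = meet-dim-resp K K M N (Same-refl K)

    columns : ∀ {j} → Enumeration (Y j ~_) (#points 5) → Enumeration (_~ Y j) (#points 5)
    columns {j} = enum-map (λ N → ∩-comm (Y j) N) (λ N → ∩-comm N (Y j))

    columns₂ : ∀ {j j′ k} → Enumeration (λ N → Y j ~ N × Y j′ ~ N) k → Enumeration (λ N → N ~ Y j × N ~ Y j′) k
    columns₂ {j} {j′} = enum-map (λ N (d , d′) → ∩-comm (Y j) N d , ∩-comm (Y j′) N d′)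
      (λ N (d , d′) → ∩-comm N (Y j) d , ∩-comm N (Y j′) d′)

    -- The row i witnesses that Y j is one step away from the family, so a further step leads back
    -- into it by parity, and L lists the result. The column axioms of `Incidence` carry a row for
    -- this purpose.
    column-position : ∀ {i j} → adj i j → ∀ N → N ~ Y j → ∃ λ i → Same N (X i)
    column-position {i} {j} d N d′ = X-position N (odd-via i (Y j) N d (∩-comm N (Y j) d′))

    incidence : Incidence q m n adj
    incidence = record
      { adj? = adj?
      ; row-degree = λ i → ≡.trans
          (enumeration-count Y Y-distinct (λ {M} {N} → respʳ (X i) {M} {N}) (Y-position i) (Neighbours.neighbours (X i)) (adj? i))
          #points-5
      ; column-degree = λ {i} {j} d → ≡.trans
          (enumeration-count X X-distinct (λ {M} {N} → respˡ (Y j) {M} {N}) (column-position d)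
            (columns (Neighbours.neighbours (Y j))) (λ i → adj? i j))
          #points-5
      ; row-common = λ {i} {i′} i≢ d d′ → ≡.trans (sum-cong-≗ λ j → 𝟙-× (adj? i j) (adj? i′ j)) (≡.trans
          (enumeration-count Y Y-distinct (λ {M} {N} s (h , h′) → respʳ (X i) {M} {N} s h , respʳ (X i′) {M} {N} s h′)
            (λ N (h , _) → Y-position i N h)
            (CommonNeighbours.commonNeighbours (X i) (X i′) (common-dim i≢ d d′)) (λ j → adj? i j ×-dec adj? i′ j))
          #points-2)
      ; column-common = λ {j} {j′} j≢ d d′ → ≡.trans (sum-cong-≗ λ i → 𝟙-× (adj? i j) (adj? i j′)) (≡.trans
          (enumeration-count X X-distinct (λ {M} {N} s (h , h′) → respˡ (Y j) {M} {N} s h , respˡ (Y j′) {M} {N} s h′)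
            (λ N (h , _) → column-position d N h)
            (columns₂ (CommonNeighbours.commonNeighbours (Y j) (Y j′) (common-dim′ j≢ d d′))) (λ i → adj? i j ×-dec adj? i j′))
          #points-2)
      ; triangle = λ {i} {i′} {i″} i≢i′ i≢i″ i′≢i″ (_ , d₁ , d₂) (_ , d₃ , d₄) (_ , d₅ , d₆) →
          let (N , h , h′ , h″) = common-triangle (X i) (X i′) (X i″)
                (common-dim i≢i′ d₁ d₂) (common-dim i≢i″ d₃ d₄) (common-dim i′≢i″ d₅ d₆)
              (j , s) = Y-position i N h
          in j , respʳ (X i) {N} {Y j} s h , respʳ (X i′) {N} {Y j} s h′ , respʳ (X i″) {N} {Y j} s h″
      }

    -- A clique or coclique may use other bases than L for the same subspaces; each member is
    -- replaced by the entry of L with the same span.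
    module Embedded {xs : List Gen} (fam : All (InFamily Q M0) xs) (distinct : Distinct (member fam)) where
      embed : Fin (length xs) → Fin m
      embed s = proj₁ (X-position (member fam s) (member-odd fam s))

      embed-same : ∀ s → Same (member fam s) (X (embed s))
      embed-same s = proj₂ (X-position (member fam s) (member-odd fam s))

      embed-injective : Inj embed
      embed-injective {s} {t} eq = distinct⇒≡ (member fam) distinct
        (Same-trans {member fam s} {X (embed s)} {member fam t} (embed-same s)
          (≡.subst (λ i → Same (X i) (member fam t)) (≡.sym eq) (Same-sym {member fam t} {X (embed t)} (embed-same t))))

      embed-dim : ∀ s t → HasDim (member fam s ∩ member fam t) 3 → HasDim (X (embed s) ∩ X (embed t)) 3
      embed-dim s t = meet-dim-resp (member fam s) (X (embed s)) (member fam t) (X (embed t)) (embed-same s) (embed-same t)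

      embed-dim⁻ : ∀ s t → HasDim (X (embed s) ∩ X (embed t)) 3 → HasDim (member fam s ∩ member fam t) 3
      embed-dim⁻ s t = meet-dim-resp (X (embed s)) (member fam s) (X (embed t)) (member fam t)
        (Same-sym {member fam s} {X (embed s)} (embed-same s)) (Same-sym {member fam t} {X (embed t)} (embed-same t))

    open Incidence incidence using (Collinear)

    collinear : ∀ i i′ → HasDim (X i ∩ X i′) 3 → Collinear i i′
    collinear i i′ d = let (j , s) = Y-position i N (proj₁ N-common) in
        j , respʳ (X i) {N} {Y j} s (proj₁ N-common) , respʳ (X i′) {N} {Y j} s (proj₂ N-common)
      where
      open Enumeration (CommonNeighbours.commonNeighbours (X i) (X i′) d)
      p : Fin (#points 2)
      p = ≡.subst Fin (≡.sym #points-2) zero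
      N : Generator
      N = enum p
      N-common : X i ~ N × X i′ ~ N
      N-common = enum-hits p

    separated : ∀ C D → IsClique Q M0 C → IsCoclique Q M0 D → length C * length D < m
    separated C D (famC , pairsC) (famD , pairsD) =
      separating q m n adj incidence 2≤q 0<m EC.embed ED.embed EC.embed-injective ED.embed-injective
        (λ {s} {t} s≢t → collinear (EC.embed s) (EC.embed t)
          (EC.embed-dim s t (proj₂ (pairC s≢t))))
        (λ {s} {t} s≢t (j , d , d′) → proj₂ (pairD s≢t) (ED.embed-dim⁻ s t (common-dim (s≢t ∘ ED.embed-injective) d d′)))
      where
      pairC : ∀ {s t} → s ≢ t → (¬ Same (member famC s) (member famC t)) × HasDim (member famC s ∩ member famC t) 3
      pairC = allPairs-lookup {S = λ b b′ → (¬ SameSpace b b′) × Adjacent b b′}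
        (λ (h , d) → (λ s → h λ v → swap (s v)) , hasDim-resp swap swap d) pairsC
      pairD : ∀ {s t} → s ≢ t → (¬ Same (member famD s) (member famD t)) × (¬ HasDim (member famD s ∩ member famD t) 3)
      pairD = allPairs-lookup {S = λ b b′ → (¬ SameSpace b b′) × (¬ Adjacent b b′)}
        (λ (h , d) → (λ s → h λ v → swap (s v)) , d ∘ hasDim-resp swap swap) pairsD
      module EC = Embedded famC (λ s≢t → proj₁ (pairC s≢t))
      module ED = Embedded famD (λ s≢t → proj₁ (pairD s≢t))
      -- M0 belongs to its own family, as it meets itself in the odd dimension 5.
      0<m : 0 < m
      0<m = ℕₚ.≤-trans (s≤s z≤n) (Finₚ.toℕ<n (proj₁ (X-position G0 G0-odd)))

theorem3p1 : (q : ℕ) → IsPrimePower q →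
    (R : CommutativeRing 0ℓ 0ℓ) → Geometry.IsField R → Geometry.HasOrder R q →
    (Q : Geometry.V R 10 → CommutativeRing.Carrier R) →
    Geometry.IsQuadraticForm R Q → Geometry.PlusType R 5 Q →
    (M0 : Geometry.Gen R) → Geometry.TSSubspace R Q 5 M0 →
    Geometry.Separating R Q M0
theorem3p1 q _ R isField order Q isQuadratic (nondegenerate , _) M0 ts0 C D L clique coclique isL =
  HalfSpin.Vertices.separated R isField q order Q isQuadratic nondegenerate M0 ts0 L isL C D clique coclique
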